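{- Let $N\geq4$. For every finite simple undirected graph $G=(V,E)$, every initial state $s_0\in S$ and every $\gamma\in(0,1)$, the game $\Gamma_N(G|s_0)$ has a Nash equilibrium $\widehat{\pi}=(\widehat{\pi}^1,\widehat{\pi}^2,\dots,\widehat{\pi}^N)$ in deterministic (generally non-positional, i.e. allowed to depend on the whole history) strategies.
   Context: Game $\Gamma_N(G|s_0)$. $N[x]$ is the closed neighborhood of $x$ in $G$. Nonterminal states: $S=\{(x^1,\dots,x^N,p): x^i\in V,\ p\in\{1,\dots,N\}\}$, where $x^i$ is the vertex of player $P_i$ and $p$ is the index of the player who moves next. There is one additional terminal state $\overline{s}$. For $n\in\{1,\dots,N-1\}$, $P_n$ captures $P_{n+1}$ in a state $s$ iff $x^n=x^{n+1}$; $S_C$ is the set of states in $S$ in which some capture occurs; $S_{NC}=S\setminus S_C$. Action sets: for $s=(x^1,\dots,x^N,p)\in S_{NC}$, $A^p(s)=N[x^p]$ and $A^m(s)=\{x^m\}$ for $m\neq p$; for $s\in S_C\cup\{\overline{s}\}$, $A^m(s)=\{\lambda\}$ (null move). Transitions: for $s=(x^1,\dots,x^N,n)\in S_{NC}$ and $a\in A^n(s)$, $\mathbf{T}(s,a)$ is obtained by replacing $x^n$ by $a$ and letting the next mover be $n+1$ (or $1$ if $n=N$). For $s\in S_C\cup\{\overline{s}\}$, $\mathbf{T}(s,\lambda)=\overline{s}$. Strategies: a deterministic strategy $\sigma^n$ assigns to each finite history $s_0s_1\dots s_t$ ($t\ge0$) an action in $A^n(s_t)$; it is positional if it depends only on $s_t$.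 A profile $\sigma$ and a starting state $s_0$ determine a play $s_0s_1s_2\dots$ with $s_{t+1}=\mathbf{T}(s_t,a)$, $a$ being the action chosen by the player who has the move (and $a=\lambda$ when $s_t\in S_C\cup\{\overline{s}\}$). $\sigma^{ -n}$ denotes the strategies of the players other than $P_n$. Turn payoffs: $q^n(s)=-1$ if $P_n$ is captured by $P_{n-1}$ in $s$ (i.e. $n\ge2$ and $x^{n-1}=x^n$); $q^n(s)=1$ if $P_n$ captures $P_{n+1}$ in $s$ (i.e. $n\le N-1$ and $x^n=x^{n+1}$) and is not simultaneously captured by $P_{n-1}$; $q^n(s)=0$ in every other case (in particular at $\overline{s}$). Total payoffs: $Q^n(s_0,\sigma)=\sum_{t=0}^\infty\gamma^tq^n(s_t)$. A Nash equilibrium of $\Gamma_N(G|s_0)$ is a profile $\widehat\sigma$ with $Q^n(s_0,\widehat\sigma)\ge Q^n(s_0,\sigma^n,\widehat\sigma^{ -n})$ for all $n\in\{1,\dots,N\}$ and all deterministic $\sigma^n$. -}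

module Defs where

open import Data.Bool.Base using (if_then_else_)
open import Data.Fin.Base using (Fin; toℕ)
open import Data.Fin.Properties using (_≟_; any?)
open import Data.List.Base using (List; []; _∷ʳ_)
open import Data.Nat.Base as ℕ using (ℕ; zero; suc)
import Data.Nat.Properties as ℕₚ
open import Data.Nat.DivMod using (_mod_)
open import Data.Product.Base using (∃; ∃-syntax; _×_; _,_; proj₁; proj₂)
open import Data.Rational.Base as ℚ using (ℚ; 0ℚ; 1ℚ)
import Data.Rational.Properties as ℚₚ
open import Data.Rational.Solver using (module +-*-Solver)
open import Data.Sum.Base using (_⊎_)
open import Data.Vec.Base using (Vec; lookup; _[_]≔_)
open import Level using (0ℓ)
open import Relation.Binary.Core using (Rel)
open import Relation.Binary.Definitions using (Decidable; Symmetric; Irreflexive)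
open import Relation.Binary.PropositionalEquality
  using (_≡_; _≢_; refl; sym; trans; cong; subst)
open import Relation.Nullary.Decidable using (Dec; yes; no; does; _×-dec_)
open import Relation.Nullary.Negation using (¬_)

------------------------------------------------------------------------
-- Real numbers

-- A real number is a Cauchy sequence of rationals.  Two sequences denote
-- the same real when their difference tends to 0; everything below
-- respects that equality, which is therefore not needed explicitly.

IsCauchy : (ℕ → ℚ) → Set
IsCauchy x = ∀ ε → 0ℚ ℚ.< ε →
  ∃[ M ] (∀ m n → M ℕ.≤ m → M ℕ.≤ n → ℚ.∣ x m ℚ.- x n ∣ ℚ.< ε)

record ℝ : Set where
  constructor mkℝ
  field
    approx : ℕ → ℚ
    cauchy : IsCauchy approx

open ℝ public

private

  halve : ∀ ε → 0ℚ ℚ.< ε → ∃[ δ ] (0ℚ ℚ.< δ × δ ℚ.+ δ ≡ ε)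
  halve ε 0<ε = ℚ.½ ℚ.* ε
    , subst (ℚ._< ℚ.½ ℚ.* ε) (ℚₚ.*-zeroʳ ℚ.½) (ℚₚ.*-monoʳ-<-pos ℚ.½ 0<ε)
    , trans (sym (ℚₚ.*-distribʳ-+ ε ℚ.½ ℚ.½)) (ℚₚ.*-identityˡ ε)

  const-cauchy : ∀ q → IsCauchy (λ _ → q)
  const-cauchy q ε 0<ε = 0 , λ _ _ _ _ →
    subst (ℚ._< ε) (sym (cong ℚ.∣_∣ (ℚₚ.+-inverseʳ q))) 0<ε

  neg-cauchy : ∀ x → IsCauchy x → IsCauchy (λ n → ℚ.- x n)
  neg-cauchy x cx ε 0<ε with cx ε 0<ε
  ... | M , h = M , λ m n M≤m M≤n →
    subst (ℚ._< ε)
      (trans (sym (ℚₚ.∣-p∣≡∣p∣ (x m ℚ.- x n)))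
             (cong ℚ.∣_∣ (ℚₚ.neg-distrib-+ (x m) (ℚ.- x n))))
      (h m n M≤m M≤n)

  +-cauchy : ∀ x y → IsCauchy x → IsCauchy y → IsCauchy (λ n → x n ℚ.+ y n)
  +-cauchy x y cx cy ε 0<ε
    with δ , 0<δ , refl ← halve ε 0<ε
    with M , h ← cx δ 0<δ
    with L , k ← cy δ 0<δ
    = M ℕ.⊔ L , λ m n p p′ →
      let a  = x m ℚ.- x n
          b  = y m ℚ.- y n
          eq = solve 4 (λ u v s t → (u :+ s) :- (v :+ t) := (u :- v) :+ (s :- t))
                 refl (x m) (x n) (y m) (y n)
      in begin-strict
        ℚ.∣ (x m ℚ.+ y m) ℚ.- (x n ℚ.+ y n) ∣ ≡⟨ cong ℚ.∣_∣ eq ⟩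
        ℚ.∣ a ℚ.+ b ∣                         ≤⟨ ℚₚ.∣p+q∣≤∣p∣+∣q∣ a b ⟩
        ℚ.∣ a ∣ ℚ.+ ℚ.∣ b ∣
          <⟨ ℚₚ.+-mono-< (h m n (ℕₚ.m⊔n≤o⇒m≤o M L p) (ℕₚ.m⊔n≤o⇒m≤o M L p′))
                         (k m n (ℕₚ.m⊔n≤o⇒n≤o M L p) (ℕₚ.m⊔n≤o⇒n≤o M L p′)) ⟩
        δ ℚ.+ δ                               ∎
    where
    open ℚₚ.≤-Reasoning
    open +-*-Solver

  bounded : ∀ x → IsCauchy x →
    ∃[ B ] (0ℚ ℚ.< B × ∃[ M ] (∀ m → M ℕ.≤ m → ℚ.∣ x m ∣ ℚ.≤ B))
  bounded x cx with cx 1ℚ (ℚₚ.positive⁻¹ 1ℚ)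
  ... | M , h = 1ℚ ℚ.+ ℚ.∣ x M ∣
    , ℚₚ.+-mono-<-≤ (ℚₚ.positive⁻¹ 1ℚ) (ℚₚ.0≤∣p∣ (x M))
    , M , λ m M≤m → begin
      ℚ.∣ x m ∣
        ≡⟨ cong ℚ.∣_∣ (solve 2 (λ u v → u := (u :- v) :+ v) refl (x m) (x M)) ⟩
      ℚ.∣ (x m ℚ.- x M) ℚ.+ x M ∣
        ≤⟨ ℚₚ.∣p+q∣≤∣p∣+∣q∣ (x m ℚ.- x M) (x M) ⟩
      ℚ.∣ x m ℚ.- x M ∣ ℚ.+ ℚ.∣ x M ∣
        ≤⟨ ℚₚ.+-monoˡ-≤ ℚ.∣ x M ∣ (ℚₚ.<⇒≤ (h m M M≤m ℕₚ.≤-refl)) ⟩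
      1ℚ ℚ.+ ℚ.∣ x M ∣ ∎
    where
    open ℚₚ.≤-Reasoning
    open +-*-Solver

  split : ∀ B C ε → 0ℚ ℚ.< B → 0ℚ ℚ.< C → 0ℚ ℚ.< ε →
    ∃[ δ ] (0ℚ ℚ.< δ × B ℚ.* δ ℚ.+ C ℚ.* δ ≡ ε)
  split B C ε 0<B 0<C 0<ε = inv (B ℚ.+ C) refl (ℚₚ.+-mono-< 0<B 0<C)
    where
    open ℚₚ.≤-Reasoning
    inv : ∀ D → B ℚ.+ C ≡ D → 0ℚ ℚ.< D →
          ∃[ δ ] (0ℚ ℚ.< δ × B ℚ.* δ ℚ.+ C ℚ.* δ ≡ ε)
    inv D B+C≡D 0<D = i ℚ.* ε , subst (ℚ._< i ℚ.* ε) (ℚₚ.*-zeroʳ i) (ℚₚ.*-monoʳ-<-pos i 0<ε)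
      , (begin-equality
        B ℚ.* (i ℚ.* ε) ℚ.+ C ℚ.* (i ℚ.* ε) ≡⟨ ℚₚ.*-distribʳ-+ (i ℚ.* ε) B C ⟨
        (B ℚ.+ C) ℚ.* (i ℚ.* ε)             ≡⟨ cong (ℚ._* (i ℚ.* ε)) B+C≡D ⟩
        D ℚ.* (i ℚ.* ε)                     ≡⟨ ℚₚ.*-assoc D i ε ⟨
        (D ℚ.* i) ℚ.* ε                     ≡⟨ cong (ℚ._* ε) (ℚₚ.*-inverseʳ D) ⟩
        1ℚ ℚ.* ε                            ≡⟨ ℚₚ.*-identityˡ ε ⟩
        ε                                   ∎)
      where
      instance
        posD = ℚ.positive 0<D
        nzD  = ℚₚ.pos⇒nonZero D
      i = ℚ.1/ D
      instance
        posi = ℚₚ.1/pos⇒pos D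

  scale : ∀ A δ p d → 0ℚ ℚ.< A → ℚ.∣ p ∣ ℚ.≤ A → ℚ.∣ d ∣ ℚ.< δ →
    ℚ.∣ p ℚ.* d ∣ ℚ.< A ℚ.* δ
  scale A δ p d 0<A p≤A d<δ = begin-strict
    ℚ.∣ p ℚ.* d ∣       ≡⟨ ℚₚ.∣p*q∣≡∣p∣*∣q∣ p d ⟩
    ℚ.∣ p ∣ ℚ.* ℚ.∣ d ∣ ≤⟨ ℚₚ.*-monoʳ-≤-nonNeg ℚ.∣ d ∣ {{ℚₚ.∣-∣-nonNeg d}} p≤A ⟩
    A ℚ.* ℚ.∣ d ∣       <⟨ ℚₚ.*-monoʳ-<-pos A {{ℚ.positive 0<A}} d<δ ⟩
    A ℚ.* δ             ∎
    where open ℚₚ.≤-Reasoning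

  *-diff : ∀ u v s t →
    u ℚ.* s ℚ.- v ℚ.* t ≡ u ℚ.* (s ℚ.- t) ℚ.+ t ℚ.* (u ℚ.- v)
  *-diff = solve 4 (λ u v s t → u :* s :- v :* t := u :* (s :- t) :+ t :* (u :- v)) refl
    where open +-*-Solver

  *-near : ∀ B C δ u v s t → 0ℚ ℚ.< B → 0ℚ ℚ.< C →
    ℚ.∣ u ∣ ℚ.≤ B → ℚ.∣ t ∣ ℚ.≤ C →
    ℚ.∣ s ℚ.- t ∣ ℚ.< δ → ℚ.∣ u ℚ.- v ∣ ℚ.< δ →
    ℚ.∣ u ℚ.* s ℚ.- v ℚ.* t ∣ ℚ.< B ℚ.* δ ℚ.+ C ℚ.* δ
  *-near B C δ u v s t 0<B 0<C u≤B t≤C s-t u-v =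
    subst (λ z → ℚ.∣ z ∣ ℚ.< B ℚ.* δ ℚ.+ C ℚ.* δ) (sym (*-diff u v s t))
      (ℚₚ.≤-<-trans
        (ℚₚ.∣p+q∣≤∣p∣+∣q∣ (u ℚ.* (s ℚ.- t)) (t ℚ.* (u ℚ.- v)))
        (ℚₚ.+-mono-<
          {ℚ.∣ u ℚ.* (s ℚ.- t) ∣} {B ℚ.* δ} {ℚ.∣ t ℚ.* (u ℚ.- v) ∣} {C ℚ.* δ}
          (scale B δ u (s ℚ.- t) 0<B u≤B s-t)
          (scale C δ t (u ℚ.- v) 0<C t≤C u-v)))

  *-cauchy : ∀ x y → IsCauchy x → IsCauchy y → IsCauchy (λ n → x n ℚ.* y n)
  *-cauchy x y cx cy ε 0<ε =
    let B , 0<B , K , b = bounded x cx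
        C , 0<C , J , c = bounded y cy
        δ , 0<δ , eq    = split B C ε 0<B 0<C 0<ε
        M , h           = cx δ 0<δ
        L , k           = cy δ 0<δ
    in combine B C δ K J M L 0<B 0<C eq b c h k
    where
    combine : ∀ B C δ K J M L → 0ℚ ℚ.< B → 0ℚ ℚ.< C → B ℚ.* δ ℚ.+ C ℚ.* δ ≡ ε →
      (∀ m → K ℕ.≤ m → ℚ.∣ x m ∣ ℚ.≤ B) → (∀ n → J ℕ.≤ n → ℚ.∣ y n ∣ ℚ.≤ C) →
      (∀ m n → M ℕ.≤ m → M ℕ.≤ n → ℚ.∣ x m ℚ.- x n ∣ ℚ.< δ) →
      (∀ m n → L ℕ.≤ m → L ℕ.≤ n → ℚ.∣ y m ℚ.- y n ∣ ℚ.< δ) →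
      ∃[ P ] (∀ m n → P ℕ.≤ m → P ℕ.≤ n →
        ℚ.∣ x m ℚ.* y m ℚ.- x n ℚ.* y n ∣ ℚ.< ε)
    combine B C δ K J M L 0<B 0<C eq b c h k = (K ℕ.⊔ J) ℕ.⊔ (M ℕ.⊔ L) , λ m n p p′ →
      let KJ≤m = ℕₚ.m⊔n≤o⇒m≤o (K ℕ.⊔ J) (M ℕ.⊔ L) p
          KJ≤n = ℕₚ.m⊔n≤o⇒m≤o (K ℕ.⊔ J) (M ℕ.⊔ L) p′
          ML≤m = ℕₚ.m⊔n≤o⇒n≤o (K ℕ.⊔ J) (M ℕ.⊔ L) p
          ML≤n = ℕₚ.m⊔n≤o⇒n≤o (K ℕ.⊔ J) (M ℕ.⊔ L) p′
      in subst (ℚ.∣ x m ℚ.* y m ℚ.- x n ℚ.* y n ∣ ℚ.<_) eq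
        (*-near B C δ (x m) (x n) (y m) (y n) 0<B 0<C
          (b m (ℕₚ.m⊔n≤o⇒m≤o K J KJ≤m))
          (c n (ℕₚ.m⊔n≤o⇒n≤o K J KJ≤n))
          (k m n (ℕₚ.m⊔n≤o⇒n≤o M L ML≤m) (ℕₚ.m⊔n≤o⇒n≤o M L ML≤n))
          (h m n (ℕₚ.m⊔n≤o⇒m≤o M L ML≤m) (ℕₚ.m⊔n≤o⇒m≤o M L ML≤n)))

fromℚ : ℚ → ℝ
fromℚ q = mkℝ (λ _ → q) (const-cauchy q)

0ℝ 1ℝ : ℝ
0ℝ = fromℚ 0ℚ
1ℝ = fromℚ 1ℚ

infix  4 _<_ _≤_ _⟶_
infixl 6 _+_ _-_
infixl 7 _*_
infixr 8 _^_
infix  8 -_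

_+_ : ℝ → ℝ → ℝ
x + y = mkℝ (λ n → approx x n ℚ.+ approx y n)
            (+-cauchy (approx x) (approx y) (cauchy x) (cauchy y))

-_ : ℝ → ℝ
- x = mkℝ (λ n → ℚ.- approx x n) (neg-cauchy (approx x) (cauchy x))

_-_ : ℝ → ℝ → ℝ
x - y = x + (- y)

_*_ : ℝ → ℝ → ℝ
x * y = mkℝ (λ n → approx x n ℚ.* approx y n)
            (*-cauchy (approx x) (approx y) (cauchy x) (cauchy y))

_^_ : ℝ → ℕ → ℝ
x ^ zero  = 1ℝ
x ^ suc t = x * x ^ t

-- A positive rational gap is needed: termwise < would not respect equality.
_<_ : ℝ → ℝ → Set
x < y = ∃[ δ ] (0ℚ ℚ.< δ ×
  ∃[ M ] (∀ m → M ℕ.≤ m → approx x m ℚ.+ δ ℚ.≤ approx y m))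

_≤_ : ℝ → ℝ → Set
x ≤ y = ¬ (y < x)

_⟶_ : (ℕ → ℝ) → ℝ → Set
u ⟶ l = ∀ ε → 0ℝ < ε →
  ∃[ M ] (∀ m → M ℕ.≤ m → (l - ε) < u m × u m < (l + ε))

partialSum : (ℕ → ℝ) → ℕ → ℝ
partialSum a zero    = 0ℝ
partialSum a (suc m) = partialSum a m + a m

-- Σ_{t≥0} a t converges and its value is v.
HasSum : (ℕ → ℝ) → ℝ → Set
HasSum a v = partialSum a ⟶ v

------------------------------------------------------------------------
-- Finite simple undirected graphs

-- The vertex set is Fin k.  Adjacency is decidable, as it is for any
-- finite graph given explicitly.
record Graph (k : ℕ) : Set₁ where
  field
    _~_       : Rel (Fin k) 0ℓ
    _~?_      : Decidable _~_
    ~-sym     : Symmetric _~_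
    ~-irrefl  : Irreflexive _≡_ _~_

  -- v ∈N[ x ]: the vertex v lies in the closed neighbourhood of x.
  _∈N[_] : Fin k → Fin k → Set
  v ∈N[ x ] = v ≡ x ⊎ x ~ v

------------------------------------------------------------------------
-- The game

-- The players P_1, …, P_N are the elements 0, …, N-1 of Fin N.

next : ∀ {N} → Fin N → Fin N
next {suc N} p = suc (toℕ p) mod suc N

module Game (N : ℕ) {k : ℕ} (G : Graph k) where

  open Graph G

  Player = Fin N
  Vertex = Fin k

  -- The nonterminal states.
  record S : Set where
    constructor _▸_
    field
      position : Vec Vertex N
      mover    : Player

    at : Player → Vertex
    at = lookup position

  open S public

  data State : Set where
    live : S → State
    s̄    : State

  -- Captures s m n: n is the player right after m, and m captures n in s.
  Captures : S → Player → Player → Set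
  Captures s m n = toℕ n ≡ suc (toℕ m) × at s m ≡ at s n

  captures? : ∀ s m n → Dec (Captures s m n)
  captures? s m n = (toℕ n ℕₚ.≟ suc (toℕ m)) ×-dec (at s m ≟ at s n)

  CaptureState : S → Set
  CaptureState s = ∃[ m ] ∃[ n ] Captures s m n

  data Action : Set where
    goto : Vertex → Action
    null : Action

  -- Allowed n s a: the action a belongs to the action set of n at s.
  data Allowed (n : Player) : State → Action → Set where
    move : ∀ {s v} → ¬ CaptureState s → n ≡ mover s → v ∈N[ at s n ] →
           Allowed n (live s) (goto v)
    stay : ∀ {s} → ¬ CaptureState s → n ≢ mover s →
           Allowed n (live s) (goto (at s n))
    captured : ∀ {s} → CaptureState s → Allowed n (live s) null
    ended    : Allowed n s̄ null

  -- On allowed actions of the mover, the first clause applies exactly at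
  -- noncapture states, and the others exactly at capture states and s̄.
  T : State → Action → State
  T (live (x ▸ p)) (goto v) = live ((x [ p ]≔ v) ▸ next p)
  T (live _)       null     = s̄
  T s̄              _        = s̄

  -- The history s₀ … s_t is given as the list s₀ … s_{t-1} (oldest state
  -- first) together with the current state s_t.
  Strategy : Player → Set
  Strategy n = (past : List State) (s : State) → ∃ (Allowed n s)

  Profile : Set
  Profile = ∀ n → Strategy n

  _[_↦_] : Profile → (n : Player) → Strategy n → Profile
  (σ [ n ↦ τ ]) m with m ≟ n
  ... | yes refl = τ
  ... | no  _    = σ m

  moverAction : Profile → List State → State → Action
  moverAction σ past (live s) = proj₁ (σ (mover s) past (live s))
  moverAction σ past s̄        = null

  -- play s₀ σ t is the history s₀ … s_t.
  play : S → Profile → ℕ → List State × State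
  play s₀ σ zero    = [] , live s₀
  play s₀ σ (suc t) = let (past , s) = play s₀ σ t in
    past ∷ʳ s , T s (moverAction σ past s)

  turnPayoff : Player → State → ℚ
  turnPayoff n (live s) =
    if does (any? λ m → captures? s m n) then ℚ.- 1ℚ
    else if does (any? λ m → captures? s n m) then 1ℚ
    else 0ℚ
  turnPayoff n s̄ = 0ℚ

  discountedPayoffs : ℝ → S → Profile → Player → ℕ → ℝ
  discountedPayoffs γ s₀ σ n t =
    γ ^ t * fromℚ (turnPayoff n (proj₂ (play s₀ σ t)))

  -- TotalPayoff γ s₀ σ n v: the series defining Qⁿ(s₀,σ) converges to v.
  TotalPayoff : ℝ → S → Profile → Player → ℝ → Set
  TotalPayoff γ s₀ σ n v = HasSum (discountedPayoffs γ s₀ σ n) v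

  -- Both total payoffs are required to exist; as limits are unique, this
  -- is the inequality Qⁿ(s₀,σ) ≥ Qⁿ(s₀,τ,σ⁻ⁿ) between the two sums.
  IsNashEquilibrium : ℝ → S → Profile → Set
  IsNashEquilibrium γ s₀ σ = ∀ n (τ : Strategy n) →
    ∃[ v ] ∃[ w ] (TotalPayoff γ s₀ σ n v ×
                   TotalPayoff γ s₀ (σ [ n ↦ τ ]) n w ×
                   w ≤ v)

{-# OPTIONS --safe #-}
module Submission where

-- At most one turn gives a player a nonzero payoff, and the resulting totals
-- γᵗ, 0 and -γᵗ are ordered in the same way for all γ ∈ (0,1).  So each
-- player's zero-sum game against all others has a solution in outcomes (win
-- at t, draw, loss at t) that does not depend on γ: iterating the one-step
-- optimality operator from the constant draw only ever replaces draws, hence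
-- reaches a fixed point because there are finitely many states.
--
-- In equilibrium every mover plays optimally in his own zero-sum game, and
-- the first player who does not is punished by the others with their optimal
-- strategy in his game.  The deviator then gets at most the value of his game
-- at the state where he deviated, while obeying yields at least that value.
-- To avoid deciding whether a capture ever takes place, outcomes are compared
-- after truncation at every horizon; the m-th approximation of a total payoff
-- is the outcome at horizon m evaluated at the m-th approximation of γ.

open import Defs
open import Data.Rational.Base as ℚ using (ℚ; 0ℚ; 1ℚ; mkℚ)
open import Algebra.Definitions.RawSemiring ℚ.+-*-rawSemiring
  using () renaming (_^_ to _^ℚ_)
open import Data.Bool.Base using (Bool; true; false; if_then_else_)
open import Data.Fin.Base using (Fin)
open import Data.Fin.Properties using (_≟_; any?)
open import Data.Integer.Base as ℤ using (+_)
import Data.Integer.Properties as ℤₚ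
open import Data.List.Base
  using (List; []; _∷_; _∷ʳ_; map; filter; length; allFin; cartesianProductWith)
import Data.List.Extrema as Extrema
open import Data.List.Membership.Propositional using (_∈_)
open import Data.List.Membership.Propositional.Properties
  using (∈-filter⁺; ∈-map⁺; ∈-allFin; ∈-cartesianProductWith⁺)
open import Data.List.Properties using (filter-notAll)
open import Data.List.Relation.Unary.All using (all?) renaming (lookup to lookupAll)
open import Data.List.Relation.Unary.All.Properties using (all-filter; ¬All⇒Any¬)
open import Data.List.Relation.Unary.Any using (here; there)
open import Data.Maybe.Base using (Maybe; just; nothing; fromMaybe)
open import Data.Nat.Base as ℕ using (ℕ; zero; suc; z≤n; s≤s)
import Data.Nat.Coprimality as Coprimality
open import Data.Nat.Induction using (<-wellFounded)
import Data.Nat.Properties as ℕₚ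
open import Data.Product.Base using (∃; ∃-syntax; _×_; _,_; proj₁; proj₂)
import Data.Rational.Properties as ℚₚ
open import Data.Rational.Solver using (module +-*-Solver)
import Data.Rational.Unnormalised.Base as ℚᵘ
import Data.Rational.Unnormalised.Properties as ℚᵘₚ
open import Data.Sum.Base using (_⊎_; inj₁; inj₂)
open import Data.Vec.Base using (Vec; []; _∷_)
import Data.Vec.Properties as Vec
open import Function.Base using (_∘_)
open import Induction.WellFounded using (Acc; acc)
open import Level using (0ℓ)
open import Relation.Binary.Bundles using (TotalOrder)
open import Relation.Binary.Definitions using (DecidableEquality)
open import Relation.Binary.PropositionalEquality
  using (_≡_; _≢_; refl; sym; trans; cong; cong₂; subst; subst₂; isEquivalence;
         module ≡-Reasoning)
open import Relation.Nullary.Decidable using (Dec; yes; no; does; _⊎-dec_)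
open import Relation.Nullary.Negation using (¬_; contradiction)
import Relation.Unary as U

-- Outcomes of a play and their order

data Reward : Set where
  gain nil penalty : Reward

payoff : Reward → ℚ
payoff gain    = 1ℚ
payoff nil     = 0ℚ
payoff penalty = ℚ.- 1ℚ

data Outcome : Set where
  win  : ℕ → Outcome
  draw : Outcome
  loss : ℕ → Outcome

infix 4 _⊑_
-- The order of the totals γᵗ, 0 and -γᵗ for γ in (0,1): earlier wins and later losses are better.
-- `value-mono` makes the connection.
data _⊑_ : Outcome → Outcome → Set where
  loss⊑loss : ∀ {t u} → t ℕ.≤ u → loss t ⊑ loss u
  loss⊑draw : ∀ {t} → loss t ⊑ draw
  loss⊑win  : ∀ {t u} → loss t ⊑ win u
  draw⊑draw : draw ⊑ draw
  draw⊑win  : ∀ {u} → draw ⊑ win u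
  win⊑win   : ∀ {t u} → u ℕ.≤ t → win t ⊑ win u

⊑-refl : ∀ {o} → o ⊑ o
⊑-refl {win _}  = win⊑win ℕₚ.≤-refl
⊑-refl {draw}   = draw⊑draw
⊑-refl {loss _} = loss⊑loss ℕₚ.≤-refl

⊑-reflexive : ∀ {o p} → o ≡ p → o ⊑ p
⊑-reflexive refl = ⊑-refl

⊑-trans : ∀ {o p q} → o ⊑ p → p ⊑ q → o ⊑ q
⊑-trans (loss⊑loss a) (loss⊑loss b) = loss⊑loss (ℕₚ.≤-trans a b)
⊑-trans (loss⊑loss _) loss⊑draw     = loss⊑draw
⊑-trans (loss⊑loss _) loss⊑win      = loss⊑win
⊑-trans loss⊑draw     draw⊑draw     = loss⊑draw
⊑-trans loss⊑draw     draw⊑win      = loss⊑win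
⊑-trans loss⊑win      (win⊑win _)   = loss⊑win
⊑-trans draw⊑draw     q             = q
⊑-trans draw⊑win      (win⊑win _)   = draw⊑win
⊑-trans (win⊑win a)   (win⊑win b)   = win⊑win (ℕₚ.≤-trans b a)

⊑-antisym : ∀ {o p} → o ⊑ p → p ⊑ o → o ≡ p
⊑-antisym (loss⊑loss a) (loss⊑loss b) = cong loss (ℕₚ.≤-antisym a b)
⊑-antisym draw⊑draw     _             = refl
⊑-antisym (win⊑win a)   (win⊑win b)   = cong win (ℕₚ.≤-antisym b a)

⊑-total : ∀ o p → o ⊑ p ⊎ p ⊑ o
⊑-total (win t) (win u) with ℕₚ.≤-total t u
... | inj₁ t≤u = inj₂ (win⊑win t≤u)
... | inj₂ u≤t = inj₁ (win⊑win u≤t)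
⊑-total (win _)  draw     = inj₂ draw⊑win
⊑-total (win _)  (loss _) = inj₂ loss⊑win
⊑-total draw     (win _)  = inj₁ draw⊑win
⊑-total draw     draw     = inj₁ draw⊑draw
⊑-total draw     (loss _) = inj₂ loss⊑draw
⊑-total (loss _) (win _)  = inj₁ loss⊑win
⊑-total (loss _) draw     = inj₁ loss⊑draw
⊑-total (loss t) (loss u) with ℕₚ.≤-total t u
... | inj₁ t≤u = inj₁ (loss⊑loss t≤u)
... | inj₂ u≤t = inj₂ (loss⊑loss u≤t)

⊑-totalOrder : TotalOrder 0ℓ 0ℓ 0ℓ
⊑-totalOrder = record
  { _≤_ = _⊑_
  ; isTotalOrder = record
    { isPartialOrder = record
      { isPreorder = record
        { isEquivalence = isEquivalence
        ; reflexive = ⊑-reflexive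
        ; trans = ⊑-trans
        }
      ; antisym = ⊑-antisym
      }
    ; total = ⊑-total
    }
  }

opposite : Outcome → Outcome
opposite (win t)  = loss t
opposite draw     = draw
opposite (loss t) = win t

opposite-involutive : ∀ o → opposite (opposite o) ≡ o
opposite-involutive (win _)  = refl
opposite-involutive draw     = refl
opposite-involutive (loss _) = refl

opposite-antitone : ∀ {o p} → o ⊑ p → opposite p ⊑ opposite o
opposite-antitone (loss⊑loss a) = win⊑win a
opposite-antitone loss⊑draw     = draw⊑win
opposite-antitone loss⊑win      = loss⊑win
opposite-antitone draw⊑draw     = draw⊑draw
opposite-antitone draw⊑win      = loss⊑draw
opposite-antitone (win⊑win a)   = loss⊑loss a

opposite-cancel : ∀ {o p} → opposite o ⊑ opposite p → p ⊑ o
opposite-cancel {o} {p} q =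
  subst₂ _⊑_ (opposite-involutive p) (opposite-involutive o) (opposite-antitone q)

delay : Outcome → Outcome
delay (win t)  = win (suc t)
delay draw     = draw
delay (loss t) = loss (suc t)

delay-mono : ∀ {o p} → o ⊑ p → delay o ⊑ delay p
delay-mono (loss⊑loss a) = loss⊑loss (s≤s a)
delay-mono loss⊑draw     = loss⊑draw
delay-mono loss⊑win      = loss⊑win
delay-mono draw⊑draw     = draw⊑draw
delay-mono draw⊑win      = draw⊑win
delay-mono (win⊑win a)   = win⊑win (s≤s a)

delay⊑win : ∀ o → delay o ⊑ win 0
delay⊑win (win _)  = win⊑win z≤n
delay⊑win draw     = draw⊑win
delay⊑win (loss _) = loss⊑win

-- Prefixing a turn, and truncation at a horizon

infixr 5 _▹_
-- What follows a nonzero reward is discarded. Along a play this loses nothing, since a capture ends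
-- the game; `value-▹` accounts for it.
_▹_ : Reward → Outcome → Outcome
gain    ▹ _ = win 0
nil     ▹ o = delay o
penalty ▹ _ = loss 0

▹-monoʳ : ∀ r {o p} → o ⊑ p → r ▹ o ⊑ r ▹ p
▹-monoʳ gain    _ = ⊑-refl
▹-monoʳ nil     q = delay-mono q
▹-monoʳ penalty _ = ⊑-refl

-- What has not happened before time h counts as a draw.
truncate : ℕ → Outcome → Outcome
truncate zero    _              = draw
truncate (suc h) draw           = draw
truncate (suc h) (win zero)     = win zero
truncate (suc h) (win (suc t))  = delay (truncate h (win t))
truncate (suc h) (loss zero)    = loss zero
truncate (suc h) (loss (suc t)) = delay (truncate h (loss t))

truncate-draw : ∀ h → truncate h draw ≡ draw
truncate-draw zero    = refl
truncate-draw (suc h) = refl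

-- The turn in front uses up one unit of the horizon. The inductions over plays and over value
-- iterates rest on this equation.
truncate-▹ : ∀ h r o → truncate (suc h) (r ▹ o) ≡ r ▹ truncate h o
truncate-▹ h gain    _        = refl
truncate-▹ h penalty _        = refl
truncate-▹ h nil     (win _)  = refl
truncate-▹ h nil     draw     = sym (cong delay (truncate-draw h))
truncate-▹ h nil     (loss _) = refl

-- Truncation can only erase a result, never move it. For this reason successive value iterates
-- differ at draws alone.
truncate-selective : ∀ h o → truncate h o ≡ o ⊎ truncate h o ≡ draw
truncate-selective zero    _           = inj₂ refl
truncate-selective (suc h) draw        = inj₁ refl
truncate-selective (suc h) (win zero)  = inj₁ refl
truncate-selective (suc h) (loss zero) = inj₁ refl
truncate-selective (suc h) (win (suc t)) with truncate-selective h (win t)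
... | inj₁ eq = inj₁ (cong delay eq)
... | inj₂ eq = inj₂ (cong delay eq)
truncate-selective (suc h) (loss (suc t)) with truncate-selective h (loss t)
... | inj₁ eq = inj₁ (cong delay eq)
... | inj₂ eq = inj₂ (cong delay eq)

draw⊑truncate-win : ∀ h t → draw ⊑ truncate h (win t)
draw⊑truncate-win h t with truncate-selective h (win t)
... | inj₁ eq = subst (draw ⊑_) (sym eq) draw⊑win
... | inj₂ eq = subst (draw ⊑_) (sym eq) draw⊑draw

truncate-loss⊑draw : ∀ h t → truncate h (loss t) ⊑ draw
truncate-loss⊑draw h t with truncate-selective h (loss t)
... | inj₁ eq = subst (_⊑ draw) (sym eq) loss⊑draw
... | inj₂ eq = subst (_⊑ draw) (sym eq) draw⊑draw

delay-opposite : ∀ o → delay (opposite o) ≡ opposite (delay o)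
delay-opposite (win _)  = refl
delay-opposite draw     = refl
delay-opposite (loss _) = refl

truncate-opposite : ∀ h o → truncate h (opposite o) ≡ opposite (truncate h o)
truncate-opposite zero    _              = refl
truncate-opposite (suc h) draw           = refl
truncate-opposite (suc h) (win zero)     = refl
truncate-opposite (suc h) (loss zero)    = refl
truncate-opposite (suc h) (win (suc t))  =
  trans (cong delay (truncate-opposite h (win t))) (delay-opposite (truncate h (win t)))
truncate-opposite (suc h) (loss (suc t)) =
  trans (cong delay (truncate-opposite h (loss t))) (delay-opposite (truncate h (loss t)))

truncate-win-mono : ∀ h {t u} → u ℕ.≤ t → truncate h (win t) ⊑ truncate h (win u)
truncate-win-mono zero    _                 = draw⊑draw
truncate-win-mono (suc h) {zero}  z≤n       = ⊑-refl
truncate-win-mono (suc h) {suc t} z≤n       = delay⊑win (truncate h (win t))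
truncate-win-mono (suc h)         (s≤s u≤t) = delay-mono (truncate-win-mono h u≤t)

truncate-mono : ∀ h {o p} → o ⊑ p → truncate h o ⊑ truncate h p
-- `opposite` exchanges wins and losses, which reduces this case to `truncate-win-mono`.
truncate-mono h (loss⊑loss {t} {u} t≤u) = opposite-cancel
  (subst₂ _⊑_ (truncate-opposite h (loss u)) (truncate-opposite h (loss t))
    (truncate-win-mono h t≤u))
truncate-mono h (loss⊑draw {t}) =
  subst (truncate h (loss t) ⊑_) (sym (truncate-draw h)) (truncate-loss⊑draw h t)
truncate-mono h (loss⊑win {t} {u}) =
  ⊑-trans (truncate-loss⊑draw h t) (draw⊑truncate-win h u)
truncate-mono h draw⊑draw               = ⊑-refl
truncate-mono h (draw⊑win {u})          =
  subst (_⊑ truncate h (win u)) (sym (truncate-draw h)) (draw⊑truncate-win h u)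
truncate-mono h (win⊑win u≤t)           = truncate-win-mono h u≤t

outcome : (ℕ → Reward) → ℕ → Outcome
outcome r zero    = draw
outcome r (suc h) = r 0 ▹ outcome (r ∘ suc) h

-- Both sides depend on the first `h` rewards only. Partial sums of different lengths are compared
-- through this equation.
truncate-outcome : ∀ r h j → truncate h (outcome r (h ℕ.+ j)) ≡ outcome r h
truncate-outcome r zero    j = refl
truncate-outcome r (suc h) j = trans
  (truncate-▹ h (r 0) (outcome (r ∘ suc) (h ℕ.+ j)))
  (cong (r 0 ▹_) (truncate-outcome (r ∘ suc) h j))


-- Powers of rationals

0≤^ : ∀ {g} → 0ℚ ℚ.≤ g → ∀ t → 0ℚ ℚ.≤ g ^ℚ t
0≤^ 0≤g zero = ℚₚ.nonNegative⁻¹ 1ℚ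
0≤^ {g} 0≤g (suc t) = subst (ℚ._≤ g ℚ.* g ^ℚ t) (ℚₚ.*-zeroʳ g)
  (ℚₚ.*-monoˡ-≤-nonNeg g {{ℚ.nonNegative 0≤g}} (0≤^ 0≤g t))

^-monoˡ-≤ : ∀ {g r} → 0ℚ ℚ.≤ g → g ℚ.≤ r → ∀ t → g ^ℚ t ℚ.≤ r ^ℚ t
^-monoˡ-≤ 0≤g g≤r zero = ℚₚ.≤-refl
^-monoˡ-≤ {g} {r} 0≤g g≤r (suc t) = ℚₚ.≤-trans
  (ℚₚ.*-monoˡ-≤-nonNeg g {{ℚ.nonNegative 0≤g}} (^-monoˡ-≤ 0≤g g≤r t))
  (ℚₚ.*-monoʳ-≤-nonNeg (r ^ℚ t) {{ℚ.nonNegative (0≤^ (ℚₚ.≤-trans 0≤g g≤r) t)}} g≤r)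

^-antitone : ∀ {g} → 0ℚ ℚ.≤ g → g ℚ.≤ 1ℚ → ∀ {t u} → t ℕ.≤ u → g ^ℚ u ℚ.≤ g ^ℚ t
^-antitone 0≤g g≤1 {u = zero} z≤n = ℚₚ.≤-refl
^-antitone {g} 0≤g g≤1 {u = suc u} z≤n = begin
  g ℚ.* g ^ℚ u  ≤⟨ ℚₚ.*-monoˡ-≤-nonNeg g {{ℚ.nonNegative 0≤g}} (^-antitone 0≤g g≤1 {u = u} z≤n) ⟩
  g ℚ.* 1ℚ      ≡⟨ ℚₚ.*-identityʳ g ⟩
  g             ≤⟨ g≤1 ⟩
  1ℚ            ∎
  where open ℚₚ.≤-Reasoning
^-antitone {g} 0≤g g≤1 (s≤s t≤u) =
  ℚₚ.*-monoˡ-≤-nonNeg g {{ℚ.nonNegative 0≤g}} (^-antitone 0≤g g≤1 t≤u)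

-- The archimedean property and vanishing powers

ι : ℕ → ℚ
ι n = mkℚ (+ n) 0 (Coprimality.sym (Coprimality.1-coprimeTo n))

ι-suc : ∀ n → ι (suc n) ≡ 1ℚ ℚ.+ ι n
ι-suc n = ℚₚ.toℚᵘ-injective (ℚᵘₚ.≃-trans
  (ℚᵘ.*≡* (cong (λ i → (+ 1 ℤ.+ i) ℤ.* + 1) (sym (ℤₚ.*-identityʳ (+ n)))))
  (ℚᵘₚ.≃-sym (ℚₚ.toℚᵘ-homo-+ 1ℚ (ι n))))

0≤ι : ∀ n → 0ℚ ℚ.≤ ι n
0≤ι n = ℚₚ.nonNegative⁻¹ (ι n)

-- The denominator of `r` serves as `K`: multiplying by it leaves the numerator, a positive integer.
archimedean : ∀ r → 0ℚ ℚ.< r → ∃[ K ] 1ℚ ℚ.≤ ι K ℚ.* r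
archimedean (mkℚ (+ zero) d _) (ℚ.*<* (ℤ.+<+ ()))
archimedean (mkℚ ℤ.-[1+ a ] d _) (ℚ.*<* ())
archimedean r@(mkℚ (+ suc a) d _) 0<r = suc d , ℚₚ.toℚᵘ-cancel-≤
  (ℚᵘₚ.≤-respʳ-≃ (ℚᵘₚ.≃-sym (ℚₚ.toℚᵘ-homo-* (ι (suc d)) r))
    (ℚᵘ.*≤* (ℤ.+≤+ (begin
      1 ℕ.* (1 ℕ.* suc d)     ≡⟨ trans (ℕₚ.*-identityˡ _) (ℕₚ.*-identityˡ (suc d)) ⟩
      suc d                   ≤⟨ ℕₚ.m≤m*n (suc d) (suc a) ⟩
      suc d ℕ.* suc a         ≡⟨ ℕₚ.*-identityʳ _ ⟨
      suc d ℕ.* suc a ℕ.* 1   ∎))))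
  where open ℕₚ.≤-Reasoning

-- Bernoulli's inequality for 1/ρ, multiplied out so that ρ may be 0. The induction step is ρ(1 +
-- (1+k)δ) ≤ ρ + (1+k)δ ≤ 1 + kδ.
bernoulli : ∀ {ρ δ} → 0ℚ ℚ.≤ ρ → 0ℚ ℚ.< δ → ρ ℚ.+ δ ℚ.≤ 1ℚ →
  ∀ K → ρ ^ℚ K ℚ.* (1ℚ ℚ.+ ι K ℚ.* δ) ℚ.≤ 1ℚ
bernoulli {ρ} {δ} 0≤ρ 0<δ ρ+δ≤1 zero = ℚₚ.≤-reflexive
  (trans (ℚₚ.*-identityˡ _) (cong (1ℚ ℚ.+_) (ℚₚ.*-zeroˡ δ)))
bernoulli {ρ} {δ} 0≤ρ 0<δ ρ+δ≤1 (suc K) = begin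
  ρ ℚ.* p ℚ.* (1ℚ ℚ.+ ι (suc K) ℚ.* δ)
    ≡⟨ cong (λ z → ρ ℚ.* p ℚ.* (1ℚ ℚ.+ z ℚ.* δ)) (ι-suc K) ⟩
  ρ ℚ.* p ℚ.* (1ℚ ℚ.+ (1ℚ ℚ.+ k) ℚ.* δ)
    ≡⟨ solve 4 (λ ρ p k δ → ρ :* p :* (con 1ℚ :+ (con 1ℚ :+ k) :* δ)
                       := p :* (ρ :+ ρ :* ((con 1ℚ :+ k) :* δ))) refl ρ p k δ ⟩
  p ℚ.* (ρ ℚ.+ ρ ℚ.* ((1ℚ ℚ.+ k) ℚ.* δ))
    ≤⟨ scaleˡ (ℚₚ.+-monoʳ-≤ ρ (ℚₚ.*-monoʳ-≤-nonNeg _ {{ℚ.nonNegative 0≤[1+k]δ}} ρ≤1)) ⟩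
  p ℚ.* (ρ ℚ.+ 1ℚ ℚ.* ((1ℚ ℚ.+ k) ℚ.* δ))
    ≡⟨ cong (p ℚ.*_) (solve 3 (λ ρ k δ → ρ :+ con 1ℚ :* ((con 1ℚ :+ k) :* δ)
                                := (ρ :+ δ) :+ k :* δ) refl ρ k δ) ⟩
  p ℚ.* ((ρ ℚ.+ δ) ℚ.+ k ℚ.* δ)
    ≤⟨ scaleˡ (ℚₚ.+-monoˡ-≤ (k ℚ.* δ) ρ+δ≤1) ⟩
  p ℚ.* (1ℚ ℚ.+ k ℚ.* δ)
    ≤⟨ bernoulli 0≤ρ 0<δ ρ+δ≤1 K ⟩
  1ℚ ∎
  where
  open ℚₚ.≤-Reasoning
  open +-*-Solver
  p = ρ ^ℚ K
  k = ι K
  scaleˡ : ∀ {x y} → x ℚ.≤ y → p ℚ.* x ℚ.≤ p ℚ.* y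
  scaleˡ = ℚₚ.*-monoˡ-≤-nonNeg p {{ℚ.nonNegative (0≤^ 0≤ρ K)}}
  ρ≤1 : ρ ℚ.≤ 1ℚ
  ρ≤1 = ℚₚ.≤-trans
    (subst (ℚ._≤ ρ ℚ.+ δ) (ℚₚ.+-identityʳ ρ) (ℚₚ.+-monoʳ-≤ ρ (ℚₚ.<⇒≤ 0<δ))) ρ+δ≤1
  0≤[1+k]δ : 0ℚ ℚ.≤ (1ℚ ℚ.+ k) ℚ.* δ
  0≤[1+k]δ = subst (ℚ._≤ (1ℚ ℚ.+ k) ℚ.* δ) (ℚₚ.*-zeroˡ δ)
    (ℚₚ.*-monoʳ-≤-nonNeg δ {{ℚ.nonNegative (ℚₚ.<⇒≤ 0<δ)}}
      (ℚₚ.+-mono-≤ (ℚₚ.nonNegative⁻¹ 1ℚ) (0≤ι K)))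

-- Choose `K` with 1 ≤ Kδε. Then ρᴷ ≤ ρᴷ(1 + Kδ)ε, and `bernoulli` bounds this by ε.
^-vanishes : ∀ {ρ δ} → 0ℚ ℚ.≤ ρ → 0ℚ ℚ.< δ → ρ ℚ.+ δ ℚ.≤ 1ℚ →
  ∀ ε → 0ℚ ℚ.< ε → ∃[ K ] ρ ^ℚ K ℚ.≤ ε
^-vanishes {ρ} {δ} 0≤ρ 0<δ ρ+δ≤1 ε 0<ε =
  K , (begin
  p                                   ≡⟨ ℚₚ.*-identityʳ p ⟨
  p ℚ.* 1ℚ                            ≤⟨ scaleˡ 1≤Kδε ⟩
  p ℚ.* (k ℚ.* (δ ℚ.* ε))             ≡⟨ cong (p ℚ.*_) (sym (ℚₚ.*-assoc k δ ε)) ⟩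
  p ℚ.* (k ℚ.* δ ℚ.* ε)
    ≤⟨ scaleˡ (ℚₚ.*-monoʳ-≤-nonNeg ε
         (subst (ℚ._≤ 1ℚ ℚ.+ k ℚ.* δ) (ℚₚ.+-identityˡ (k ℚ.* δ))
           (ℚₚ.+-monoˡ-≤ (k ℚ.* δ) (ℚₚ.nonNegative⁻¹ 1ℚ)))) ⟩
  p ℚ.* ((1ℚ ℚ.+ k ℚ.* δ) ℚ.* ε)      ≡⟨ ℚₚ.*-assoc p _ ε ⟨
  p ℚ.* (1ℚ ℚ.+ k ℚ.* δ) ℚ.* ε        ≤⟨ ℚₚ.*-monoʳ-≤-nonNeg ε (bernoulli 0≤ρ 0<δ ρ+δ≤1 K) ⟩
  1ℚ ℚ.* ε                            ≡⟨ ℚₚ.*-identityˡ ε ⟩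
  ε                                   ∎)
  where
  open ℚₚ.≤-Reasoning
  instance
    nonNeg-ε = ℚ.nonNegative (ℚₚ.<⇒≤ 0<ε)
  0<δε : 0ℚ ℚ.< δ ℚ.* ε
  0<δε = subst (ℚ._< δ ℚ.* ε) (ℚₚ.*-zeroˡ ε)
    (ℚₚ.*-monoˡ-<-pos ε {{ℚ.positive 0<ε}} 0<δ)
  K = proj₁ (archimedean (δ ℚ.* ε) 0<δε)
  1≤Kδε = proj₂ (archimedean (δ ℚ.* ε) 0<δε)
  p = ρ ^ℚ K
  k = ι K
  scaleˡ : ∀ {x y} → x ℚ.≤ y → p ℚ.* x ℚ.≤ p ℚ.* y
  scaleˡ = ℚₚ.*-monoˡ-≤-nonNeg p {{ℚ.nonNegative (0≤^ 0≤ρ K)}}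

-- Values of outcomes at a rational discount factor

value : ℚ → Outcome → ℚ
value g (win t)  = g ^ℚ t
value g draw     = 0ℚ
value g (loss t) = ℚ.- (g ^ℚ t)

value-delay : ∀ g o → value g (delay o) ≡ g ℚ.* value g o
value-delay g (win t)  = refl
value-delay g draw     = sym (ℚₚ.*-zeroʳ g)
value-delay g (loss t) = ℚₚ.neg-distribʳ-* g (g ^ℚ t)

value-mono : ∀ {g} → 0ℚ ℚ.≤ g → g ℚ.≤ 1ℚ → ∀ {o p} → o ⊑ p → value g o ℚ.≤ value g p
value-mono 0≤g g≤1 (loss⊑loss t≤u)    = ℚₚ.neg-antimono-≤ (^-antitone 0≤g g≤1 t≤u)
value-mono 0≤g g≤1 (loss⊑draw {t})    = ℚₚ.neg-antimono-≤ (0≤^ 0≤g t)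
value-mono 0≤g g≤1 (loss⊑win {t} {u}) = ℚₚ.≤-trans (ℚₚ.neg-antimono-≤ (0≤^ 0≤g t)) (0≤^ 0≤g u)
value-mono 0≤g g≤1 draw⊑draw          = ℚₚ.≤-refl
value-mono 0≤g g≤1 (draw⊑win {u})     = 0≤^ 0≤g u
value-mono 0≤g g≤1 (win⊑win u≤t)      = ^-antitone 0≤g g≤1 u≤t

-- Truncation erases only a win or loss at some t ≥ h, which is worth at most gʰ in absolute value.
-- The induction extracts one factor `g` per delayed turn.
value-truncate : ∀ {g} → 0ℚ ℚ.≤ g → g ℚ.≤ 1ℚ → ∀ h o →
  ℚ.∣ value g (truncate h o) ℚ.- value g o ∣ ℚ.≤ g ^ℚ h
value-truncate {g} 0≤g g≤1 = helper
  where
  open ℚₚ.≤-Reasoning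
  ∣g∣≡g : ℚ.∣ g ∣ ≡ g
  ∣g∣≡g = ℚₚ.0≤p⇒∣p∣≡p 0≤g

  exact : ∀ x h → ℚ.∣ x ℚ.- x ∣ ℚ.≤ g ^ℚ h
  exact x h = subst (ℚ._≤ g ^ℚ h) (sym (cong ℚ.∣_∣ (ℚₚ.+-inverseʳ x))) (0≤^ 0≤g h)

  power≤1 : ∀ t → ℚ.∣ g ^ℚ t ∣ ℚ.≤ 1ℚ
  power≤1 t = subst (ℚ._≤ 1ℚ) (sym (ℚₚ.0≤p⇒∣p∣≡p (0≤^ 0≤g t))) (^-antitone 0≤g g≤1 (z≤n {t}))

  delayed : ∀ h o p → ℚ.∣ value g o ℚ.- value g p ∣ ℚ.≤ g ^ℚ h →
    ℚ.∣ value g (delay o) ℚ.- value g (delay p) ∣ ℚ.≤ g ^ℚ suc h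
  delayed h o p near = begin
    ℚ.∣ value g (delay o) ℚ.- value g (delay p) ∣
      ≡⟨ cong₂ (λ x y → ℚ.∣ x ℚ.- y ∣) (value-delay g o) (value-delay g p) ⟩
    ℚ.∣ g ℚ.* value g o ℚ.- g ℚ.* value g p ∣
      ≡⟨ cong ℚ.∣_∣ (solve 3 (λ g x y → g :* x :- g :* y := g :* (x :- y)) refl
           g (value g o) (value g p)) ⟩
    ℚ.∣ g ℚ.* (value g o ℚ.- value g p) ∣      ≡⟨ ℚₚ.∣p*q∣≡∣p∣*∣q∣ g _ ⟩
    ℚ.∣ g ∣ ℚ.* ℚ.∣ value g o ℚ.- value g p ∣  ≡⟨ cong (ℚ._* ℚ.∣ value g o ℚ.- value g p ∣) ∣g∣≡g ⟩
    g ℚ.* ℚ.∣ value g o ℚ.- value g p ∣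
      ≤⟨ ℚₚ.*-monoˡ-≤-nonNeg g {{ℚ.nonNegative 0≤g}} near ⟩
    g ℚ.* g ^ℚ h ∎
    where open +-*-Solver

  helper : ∀ h o → ℚ.∣ value g (truncate h o) ℚ.- value g o ∣ ℚ.≤ g ^ℚ h
  helper h       draw           = subst (λ o → ℚ.∣ value g o ℚ.- 0ℚ ∣ ℚ.≤ g ^ℚ h)
    (sym (truncate-draw h)) (exact 0ℚ h)
  helper zero    (win t)        = subst (ℚ._≤ 1ℚ)
    (sym (trans (cong ℚ.∣_∣ (ℚₚ.+-identityˡ _)) (ℚₚ.∣-p∣≡∣p∣ (g ^ℚ t)))) (power≤1 t)
  helper zero    (loss t)       = subst (ℚ._≤ 1ℚ)
    (sym (trans (cong ℚ.∣_∣ (ℚₚ.+-identityˡ _))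
      (trans (ℚₚ.∣-p∣≡∣p∣ (ℚ.- (g ^ℚ t))) (ℚₚ.∣-p∣≡∣p∣ (g ^ℚ t))))) (power≤1 t)
  helper (suc h) (win zero)     = exact 1ℚ (suc h)
  helper (suc h) (win (suc t))  = delayed h (truncate h (win t)) (win t) (helper h (win t))
  helper (suc h) (loss zero)    = exact (ℚ.- 1ℚ) (suc h)
  helper (suc h) (loss (suc t)) = delayed h (truncate h (loss t)) (loss t) (helper h (loss t))

-- Discounted sums

private
  -- Four parts serve both uses: `chain` spends three and keeps one for strictness, while `margin`
  -- spends two on the distance and one on the rational gap that `_<_` demands.
  quarter : ∀ ε → 0ℚ ℚ.< ε → ∃[ η ] (0ℚ ℚ.< η × η ℚ.+ η ℚ.+ η ℚ.+ η ≡ ε)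
  quarter ε 0<ε = ¼ ℚ.* ε
    , subst (ℚ._< ¼ ℚ.* ε) (ℚₚ.*-zeroʳ ¼) (ℚₚ.*-monoʳ-<-pos ¼ 0<ε)
    , solve 1 (λ ε → con ¼ :* ε :+ con ¼ :* ε :+ con ¼ :* ε :+ con ¼ :* ε := ε) refl ε
    where
    open +-*-Solver
    ¼ = ℚ.½ ℚ.* ℚ.½

  triangle : ∀ {η a b c} → ℚ.∣ a ℚ.- b ∣ ℚ.≤ η → ℚ.∣ a ℚ.- c ∣ ℚ.≤ η →
    ℚ.∣ b ℚ.- c ∣ ℚ.≤ η ℚ.+ η
  triangle {η} {a} {b} {c} a-b a-c = begin
    ℚ.∣ b ℚ.- c ∣
      ≡⟨ cong ℚ.∣_∣ (solve 3 (λ a b c → b :- c := (a :- c) :- (a :- b)) refl a b c) ⟩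
    ℚ.∣ (a ℚ.- c) ℚ.- (a ℚ.- b) ∣
      ≤⟨ ℚₚ.∣p-q∣≤∣p∣+∣q∣ (a ℚ.- c) (a ℚ.- b) ⟩
    ℚ.∣ a ℚ.- c ∣ ℚ.+ ℚ.∣ a ℚ.- b ∣
      ≤⟨ ℚₚ.+-mono-≤ {ℚ.∣ a ℚ.- c ∣} {η} {ℚ.∣ a ℚ.- b ∣} {η} a-c a-b ⟩
    η ℚ.+ η ∎
    where
    open ℚₚ.≤-Reasoning
    open +-*-Solver

  p≤∣p∣ : ∀ p → p ℚ.≤ ℚ.∣ p ∣
  p≤∣p∣ p with ℚₚ.≤-total 0ℚ p
  ... | inj₁ 0≤p = ℚₚ.≤-reflexive (sym (ℚₚ.0≤p⇒∣p∣≡p 0≤p))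
  ... | inj₂ p≤0 = ℚₚ.≤-trans p≤0 (ℚₚ.0≤∣p∣ p)

  chain : ∀ {η a b c d} → 0ℚ ℚ.< η →
    ℚ.∣ b ℚ.- a ∣ ℚ.≤ η → ℚ.∣ b ℚ.- c ∣ ℚ.< η → ℚ.∣ c ℚ.- d ∣ ℚ.≤ η →
    ℚ.∣ a ℚ.- d ∣ ℚ.< η ℚ.+ η ℚ.+ η ℚ.+ η
  chain {η} {a} {b} {c} {d} 0<η b-a b-c c-d = begin-strict
    ℚ.∣ a ℚ.- d ∣
      ≡⟨ cong ℚ.∣_∣ (solve 3 (λ a c d → a :- d := (a :- c) :+ (c :- d)) refl a c d) ⟩
    ℚ.∣ (a ℚ.- c) ℚ.+ (c ℚ.- d) ∣
      ≤⟨ ℚₚ.∣p+q∣≤∣p∣+∣q∣ (a ℚ.- c) (c ℚ.- d) ⟩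
    ℚ.∣ a ℚ.- c ∣ ℚ.+ ℚ.∣ c ℚ.- d ∣
      ≤⟨ ℚₚ.+-mono-≤ {ℚ.∣ a ℚ.- c ∣} {η ℚ.+ η} {ℚ.∣ c ℚ.- d ∣} {η}
           (triangle {η} {b} {a} {c} b-a (ℚₚ.<⇒≤ b-c)) c-d ⟩
    η ℚ.+ η ℚ.+ η         ≡⟨ ℚₚ.+-identityʳ (η ℚ.+ η ℚ.+ η) ⟨
    η ℚ.+ η ℚ.+ η ℚ.+ 0ℚ  <⟨ ℚₚ.+-monoʳ-< (η ℚ.+ η ℚ.+ η) 0<η ⟩
    η ℚ.+ η ℚ.+ η ℚ.+ η   ∎
    where
    open ℚₚ.≤-Reasoning
    open +-*-Solver

  margin : ∀ {η b c e} → 0ℚ ℚ.< η →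
    ℚ.∣ b ℚ.- c ∣ ℚ.≤ η ℚ.+ η → 0ℚ ℚ.+ (η ℚ.+ η ℚ.+ η ℚ.+ η) ℚ.≤ e → b ℚ.+ η ℚ.≤ c ℚ.+ e
  margin {η} {b} {c} {e} 0<η b-c 4η≤e = begin
    b ℚ.+ η                ≡⟨ solve 3 (λ b c η → b :+ η := c :+ ((b :- c) :+ η)) refl b c η ⟩
    c ℚ.+ ((b ℚ.- c) ℚ.+ η)
      ≤⟨ ℚₚ.+-monoʳ-≤ c (ℚₚ.+-monoˡ-≤ η (ℚₚ.≤-trans (p≤∣p∣ (b ℚ.- c)) b-c)) ⟩
    c ℚ.+ (η ℚ.+ η ℚ.+ η)
      ≡⟨ cong (c ℚ.+_) (ℚₚ.+-identityʳ (η ℚ.+ η ℚ.+ η)) ⟨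
    c ℚ.+ (η ℚ.+ η ℚ.+ η ℚ.+ 0ℚ)
      ≤⟨ ℚₚ.+-monoʳ-≤ c (ℚₚ.+-monoʳ-≤ (η ℚ.+ η ℚ.+ η) (ℚₚ.<⇒≤ 0<η)) ⟩
    c ℚ.+ (η ℚ.+ η ℚ.+ η ℚ.+ η)
      ≡⟨ cong (c ℚ.+_) (ℚₚ.+-identityˡ (η ℚ.+ η ℚ.+ η ℚ.+ η)) ⟨
    c ℚ.+ (0ℚ ℚ.+ (η ℚ.+ η ℚ.+ η ℚ.+ η))
      ≤⟨ ℚₚ.+-monoʳ-≤ c 4η≤e ⟩
    c ℚ.+ e ∎
    where
    open ℚₚ.≤-Reasoning
    open +-*-Solver

  margin⁻ : ∀ {η b c e} → 0ℚ ℚ.< η →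
    ℚ.∣ b ℚ.- c ∣ ℚ.≤ η ℚ.+ η → 0ℚ ℚ.+ (η ℚ.+ η ℚ.+ η ℚ.+ η) ℚ.≤ e → (b ℚ.- e) ℚ.+ η ℚ.≤ c
  margin⁻ {η} {b} {c} {e} 0<η b-c 4η≤e = begin
    (b ℚ.- e) ℚ.+ η  ≡⟨ solve 3 (λ b e η → (b :- e) :+ η := (b :+ η) :- e) refl b e η ⟩
    (b ℚ.+ η) ℚ.- e  ≤⟨ ℚₚ.+-monoˡ-≤ (ℚ.- e) (margin {η} {b} {c} {e} 0<η b-c 4η≤e) ⟩
    (c ℚ.+ e) ℚ.- e  ≡⟨ solve 2 (λ c e → (c :+ e) :- e := c) refl c e ⟩
    c                ∎
    where
    open ℚₚ.≤-Reasoning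
    open +-*-Solver

-- The diagonal represents the limit as soon as the approximations with
-- large index stabilise uniformly in the index.
module DiagonalLimit (u : ℕ → ℝ)
  (stable : ∀ ε → 0ℚ ℚ.< ε → ∃[ K ] (∀ h m → K ℕ.≤ h → K ℕ.≤ m →
    ℚ.∣ approx (u K) m ℚ.- approx (u h) m ∣ ℚ.≤ ε)) where

  -- The diagonal entries at `m` and `n` are joined through the fixed real `u K`: first at index
  -- `m`, then along its own Cauchy sequence to `n`, then back to the diagonal.
  diagonal-cauchy : IsCauchy (λ m → approx (u m) m)
  diagonal-cauchy ε 0<ε =
    let η , 0<η , 4η≡ε = quarter ε 0<ε
        K , near       = stable η 0<η
        L , fixed      = cauchy (u K) η 0<η
    in K ℕ.⊔ L , λ m n p q →
      let K≤m = ℕₚ.m⊔n≤o⇒m≤o K L p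
          K≤n = ℕₚ.m⊔n≤o⇒m≤o K L q
      in subst (ℚ.∣ approx (u m) m ℚ.- approx (u n) n ∣ ℚ.<_) 4η≡ε
        (chain {η} {approx (u m) m} {approx (u K) m} {approx (u K) n} {approx (u n) n} 0<η
          (near m m K≤m K≤m)
          (fixed m n (ℕₚ.m⊔n≤o⇒n≤o K L p) (ℕₚ.m⊔n≤o⇒n≤o K L q))
          (near n n K≤n K≤n))

  diagonal : ℝ
  diagonal = mkℝ (λ m → approx (u m) m) diagonal-cauchy

  -- At each large index `m`, both `u h` and the diagonal lie within η of `u K`, hence within 2η of
  -- each other. As the tolerance is at least 4η there, η is left as the gap.
  ⟶-diagonal : u ⟶ diagonal
  ⟶-diagonal ε (δ , 0<δ , M , δ≤ε) =
    let η , 0<η , 4η≡δ = quarter δ 0<δ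
        K , near       = stable η 0<η
        large : ∀ m → K ℕ.⊔ M ℕ.≤ m → 0ℚ ℚ.+ (η ℚ.+ η ℚ.+ η ℚ.+ η) ℚ.≤ approx ε m
        large m p      = subst (λ δ → 0ℚ ℚ.+ δ ℚ.≤ approx ε m) (sym 4η≡δ)
                           (δ≤ε m (ℕₚ.m⊔n≤o⇒n≤o K M p))
        K≤ : ∀ m → K ℕ.⊔ M ℕ.≤ m → K ℕ.≤ m
        K≤ m p         = ℕₚ.m⊔n≤o⇒m≤o K M p
    in K , λ h K≤h →
        (η , 0<η , K ℕ.⊔ M , λ m p →
          margin⁻ {η} {approx (u m) m} {approx (u h) m} {approx ε m} 0<η
            (triangle {η} {approx (u K) m} {approx (u m) m} {approx (u h) m}
              (near m m (K≤ m p) (K≤ m p)) (near h m K≤h (K≤ m p)))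
            (large m p))
      , (η , 0<η , K ℕ.⊔ M , λ m p →
          margin {η} {approx (u h) m} {approx (u m) m} {approx ε m} 0<η
            (triangle {η} {approx (u K) m} {approx (u h) m} {approx (u m) m}
              (near h m K≤h (K≤ m p)) (near m m (K≤ m p) (K≤ m p)))
            (large m p))

discounted : ℝ → (ℕ → ℚ) → ℕ → ℝ
discounted γ q t = γ ^ t * fromℚ (q t)

-- ℚ's operations unfold on neutral terms, which makes conversion checking
-- slow: hence these one-step conversions and the lemmas over variables.
approx-partialSum-suc : ∀ a h m →
  approx (partialSum a (suc h)) m ≡ approx (partialSum a h) m ℚ.+ approx (a h) m
approx-partialSum-suc a h m = refl

approx-discounted : ∀ γ q t m → approx (discounted γ q t) m ≡ approx (γ ^ t) m ℚ.* q t
approx-discounted γ q t m = refl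

approx-^-suc : ∀ γ t m → approx (γ ^ suc t) m ≡ approx γ m ℚ.* approx (γ ^ t) m
approx-^-suc γ t m = refl

private
  first-term : ∀ S z s d p q g → S ≡ z ℚ.+ d → z ≡ 0ℚ → s ≡ 0ℚ → d ≡ p ℚ.* q → p ≡ 1ℚ →
    S ≡ q ℚ.+ g ℚ.* s
  first-term _ _ _ _ _ q g refl refl refl refl refl =
    solve 2 (λ q g → con 0ℚ :+ con 1ℚ :* q := q :+ g :* con 0ℚ) refl q g
    where open +-*-Solver

  further-term : ∀ q₀ g S S′ d p′ q s s′ d′ p →
    S′ ≡ S ℚ.+ d → d ≡ p′ ℚ.* q → p′ ≡ g ℚ.* p → S ≡ q₀ ℚ.+ g ℚ.* s →
    s′ ≡ s ℚ.+ d′ → d′ ≡ p ℚ.* q → S′ ≡ q₀ ℚ.+ g ℚ.* s′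
  further-term q₀ g _ _ _ _ q s _ _ p refl refl refl refl refl refl =
    solve 5 (λ q₀ g s p q → (q₀ :+ g :* s) :+ g :* p :* q := q₀ :+ g :* (s :+ p :* q)) refl
      q₀ g s p q
    where open +-*-Solver

-- `partialSum` grows at its end, whereas `outcome` consumes rewards from the front. This Horner
-- form lets one induction treat both.
partialSum-suc : ∀ γ q m h →
  approx (partialSum (discounted γ q) (suc h)) m
    ≡ q 0 ℚ.+ approx γ m ℚ.* approx (partialSum (discounted γ (λ t → q (suc t))) h) m
partialSum-suc γ q m zero = first-term
  (approx (partialSum (discounted γ q) 1) m)
  (approx (partialSum (discounted γ q) 0) m)
  (approx (partialSum (discounted γ (λ t → q (suc t))) 0) m)
  (approx (discounted γ q 0) m) (approx (γ ^ 0) m) (q 0) (approx γ m)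
  (approx-partialSum-suc (discounted γ q) 0 m) refl refl (approx-discounted γ q 0 m) refl
partialSum-suc γ q m (suc h) = further-term (q 0) (approx γ m)
  (approx (partialSum (discounted γ q) (suc h)) m)
  (approx (partialSum (discounted γ q) (suc (suc h))) m)
  (approx (discounted γ q (suc h)) m) (approx (γ ^ suc h) m) (q (suc h))
  (approx (partialSum (discounted γ (λ t → q (suc t))) h) m)
  (approx (partialSum (discounted γ (λ t → q (suc t))) (suc h)) m)
  (approx (discounted γ (λ t → q (suc t)) h) m) (approx (γ ^ h) m)
  (approx-partialSum-suc (discounted γ q) (suc h) m)
  (approx-discounted γ q (suc h) m) (approx-^-suc γ h m)
  (partialSum-suc γ q m h)
  (approx-partialSum-suc (discounted γ (λ t → q (suc t))) h m)
  (approx-discounted γ (λ t → q (suc t)) h m)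

-- At most one reward is nonzero, phrased turn by turn so that it can be established by inspecting
-- one state instead of searching the whole play.
Settled : (ℕ → Reward) → Set
Settled r = ∀ t → r t ≡ nil ⊎ (∀ u → r (suc t ℕ.+ u) ≡ nil)

settled-suc : ∀ {r} → Settled r → Settled (r ∘ suc)
settled-suc settled t = settled (suc t)

outcome-nil : ∀ {r} → (∀ t → r t ≡ nil) → ∀ h → outcome r h ≡ draw
outcome-nil r≡nil zero = refl
outcome-nil r≡nil (suc h) = cong₂ _▹_ (r≡nil 0) (outcome-nil (r≡nil ∘ suc) h)

-- The disjunction is exactly what makes discarding the tail in `▹` harmless.
value-▹ : ∀ g r o → r ≡ nil ⊎ o ≡ draw → payoff r ℚ.+ g ℚ.* value g o ≡ value g (r ▹ o)
value-▹ g nil o _ = trans (ℚₚ.+-identityˡ _) (sym (value-delay g o))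
value-▹ g gain .draw (inj₂ refl) = trans (cong (1ℚ ℚ.+_) (ℚₚ.*-zeroʳ g)) (ℚₚ.+-identityʳ 1ℚ)
value-▹ g penalty .draw (inj₂ refl) =
  trans (cong (ℚ.- 1ℚ ℚ.+_) (ℚₚ.*-zeroʳ g)) (ℚₚ.+-identityʳ (ℚ.- 1ℚ))

-- At most one term of the sum is nonzero, so it is a single power up to sign, or 0. The identity is
-- exact at every index `m`, not merely in the limit.
partialSum≡value : ∀ γ m h {q r} → (∀ t → q t ≡ payoff (r t)) → Settled r →
  approx (partialSum (discounted γ q) h) m ≡ value (approx γ m) (outcome r h)
partialSum≡value γ m zero q≡r settled = refl
partialSum≡value γ m (suc h) {q} {r} q≡r settled =
  let S = approx (partialSum (discounted γ (λ t → q (suc t))) h) m in begin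
  approx (partialSum (discounted γ q) (suc h)) m
    ≡⟨ partialSum-suc γ q m h ⟩
  q 0 ℚ.+ approx γ m ℚ.* S
    ≡⟨ cong (ℚ._+ approx γ m ℚ.* S) (q≡r 0) ⟩
  payoff (r 0) ℚ.+ approx γ m ℚ.* S
    ≡⟨ cong (λ s → payoff (r 0) ℚ.+ approx γ m ℚ.* s)
         (partialSum≡value γ m h {λ t → q (suc t)} {r ∘ suc} (λ t → q≡r (suc t))
           (settled-suc settled)) ⟩
  payoff (r 0) ℚ.+ approx γ m ℚ.* value (approx γ m) (outcome (r ∘ suc) h)
    ≡⟨ value-▹ (approx γ m) (r 0) (outcome (r ∘ suc) h) rest ⟩
  value (approx γ m) (r 0 ▹ outcome (r ∘ suc) h) ∎
  where
  open ≡-Reasoning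
  rest : r 0 ≡ nil ⊎ outcome (r ∘ suc) h ≡ draw
  rest with settled 0
  ... | inj₁ eq  = inj₁ eq
  ... | inj₂ eqs = inj₂ (outcome-nil eqs h)

-- The gaps hidden in 0 < γ < 1, made uniform: past `onset` all approximations of γ lie in [0, ρ]
-- with ρ rational and below 1. Earlier approximations may be arbitrary.
record Discount (γ : ℝ) : Set where
  field
    ρ δ     : ℚ
    0≤ρ     : 0ℚ ℚ.≤ ρ
    0<δ     : 0ℚ ℚ.< δ
    ρ+δ≤1   : ρ ℚ.+ δ ℚ.≤ 1ℚ
    onset   : ℕ
    0≤γ     : ∀ {m} → onset ℕ.≤ m → 0ℚ ℚ.≤ approx γ m
    γ≤ρ     : ∀ {m} → onset ℕ.≤ m → approx γ m ℚ.≤ ρ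

discount : ∀ γ → 0ℝ < γ → γ < 1ℝ → Discount γ
discount γ (η , 0<η , M , η≤γ) (δ , 0<δ , L , γ+δ≤1) = record
  { ρ     = 1ℚ ℚ.- δ
  ; δ     = δ
  -- The approximation of γ at the onset itself lies between 0 and ρ.
  ; 0≤ρ   = ℚₚ.≤-trans (0≤γ ℕₚ.≤-refl) (γ≤ρ ℕₚ.≤-refl)
  ; 0<δ   = 0<δ
  ; ρ+δ≤1 = ℚₚ.≤-reflexive (solve 1 (λ δ → con 1ℚ :- δ :+ δ := con 1ℚ) refl δ)
  ; onset = M ℕ.⊔ L
  ; 0≤γ   = 0≤γ
  ; γ≤ρ   = γ≤ρ
  }
  where
  open +-*-Solver
  0≤γ : ∀ {m} → M ℕ.⊔ L ℕ.≤ m → 0ℚ ℚ.≤ approx γ m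
  0≤γ {m} p = ℚₚ.≤-trans (ℚₚ.<⇒≤ 0<η)
    (subst (ℚ._≤ approx γ m) (ℚₚ.+-identityˡ η) (η≤γ m (ℕₚ.m⊔n≤o⇒m≤o M L p)))

  γ≤ρ : ∀ {m} → M ℕ.⊔ L ℕ.≤ m → approx γ m ℚ.≤ 1ℚ ℚ.- δ
  γ≤ρ {m} p = subst (ℚ._≤ 1ℚ ℚ.- δ) (cancel (approx γ m) δ)
    (ℚₚ.+-monoˡ-≤ (ℚ.- δ) (γ+δ≤1 m (ℕₚ.m⊔n≤o⇒n≤o M L p)))
    where
    cancel : ∀ g δ → g ℚ.+ δ ℚ.- δ ≡ g
    cancel = solve 2 (λ g δ → g :+ δ :- δ := g) refl

-- Existence and comparison of total payoffs

module Discounting {γ : ℝ} (γ-discount : Discount γ) where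

  open Discount γ-discount

  private
    ρ≤1 : ρ ℚ.≤ 1ℚ
    ρ≤1 = ℚₚ.≤-trans
      (subst (ℚ._≤ ρ ℚ.+ δ) (ℚₚ.+-identityʳ ρ) (ℚₚ.+-monoʳ-≤ ρ (ℚₚ.<⇒≤ 0<δ))) ρ+δ≤1

    γ≤1 : ∀ {m} → onset ℕ.≤ m → approx γ m ℚ.≤ 1ℚ
    γ≤1 p = ℚₚ.≤-trans (γ≤ρ p) ρ≤1

    truncation-error : ∀ {g h S S′ o o′} → 0ℚ ℚ.≤ g → g ℚ.≤ 1ℚ →
      S ≡ value g o → S′ ≡ value g o′ → truncate h o′ ≡ o → ℚ.∣ S ℚ.- S′ ∣ ℚ.≤ g ^ℚ h
    truncation-error {h = h} {o′ = o′} 0≤g g≤1 refl refl refl = value-truncate 0≤g g≤1 h o′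

  module _ {q : ℕ → ℚ} {r : ℕ → Reward}
    (q≡r : ∀ t → q t ≡ payoff (r t)) (settled : Settled r) where

    -- The first `K` rewards fix the outcome up to truncation at `K`, so `value-truncate` applies.
    -- Passing from the approximation of γ to ρ makes the bound independent of `m`.
    partialSum-near : ∀ K h m → onset ℕ.≤ m → K ℕ.≤ h →
      ℚ.∣ approx (partialSum (discounted γ q) K) m ℚ.-
          approx (partialSum (discounted γ q) h) m ∣ ℚ.≤ ρ ^ℚ K
    partialSum-near K h m onset≤m K≤h = ℚₚ.≤-trans
      (truncation-error {approx γ m} {K}
        {approx (partialSum (discounted γ q) K) m} {approx (partialSum (discounted γ q) h) m}
        {outcome r K} {outcome r h} (0≤γ onset≤m) (γ≤1 onset≤m)
        (partialSum≡value γ m K q≡r settled) (partialSum≡value γ m h q≡r settled)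
        (subst (λ h → truncate K (outcome r h) ≡ outcome r K)
          (ℕₚ.m+[n∸m]≡n K≤h) (truncate-outcome r K (h ℕ.∸ K))))
      (^-monoˡ-≤ (0≤γ onset≤m) (γ≤ρ onset≤m) K)

    partialSum-stable : ∀ ε → 0ℚ ℚ.< ε → ∃[ K ] (∀ h m → K ℕ.≤ h → K ℕ.≤ m →
      ℚ.∣ approx (partialSum (discounted γ q) K) m ℚ.-
          approx (partialSum (discounted γ q) h) m ∣ ℚ.≤ ε)
    partialSum-stable ε 0<ε =
      let L , ρᴸ≤ε = ^-vanishes 0≤ρ 0<δ ρ+δ≤1 ε 0<ε
      -- The same threshold bounds `m`, so it has to clear `onset` as well.
      in onset ℕ.⊔ L , λ h m K≤h K≤m → ℚₚ.≤-trans
        (partialSum-near (onset ℕ.⊔ L) h m (ℕₚ.m⊔n≤o⇒m≤o onset L K≤m) K≤h)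
        (ℚₚ.≤-trans (^-antitone 0≤ρ ρ≤1 (ℕₚ.m≤n⊔m onset L)) ρᴸ≤ε)

    open DiagonalLimit (partialSum (discounted γ q)) partialSum-stable public
      using () renaming (diagonal to total; ⟶-diagonal to hasSum-total)

    total≡value : ∀ m → approx total m ≡ value (approx γ m) (outcome r m)
    total≡value m = partialSum≡value γ m m q≡r settled

  total-mono : ∀ {q r q′ r′}
    (q≡r : ∀ t → q t ≡ payoff (r t)) (settled : Settled r)
    (q′≡r′ : ∀ t → q′ t ≡ payoff (r′ t)) (settled′ : Settled r′) →
    (∀ h → outcome r h ⊑ outcome r′ h) →
    total {q} {r} q≡r settled ≤ total {q′} {r′} q′≡r′ settled′
  total-mono {q} {r} {q′} {r′} q≡r settled q′≡r′ settled′ r⊑r′ (δ , 0<δ , M , larger) =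
    ℚₚ.<-irrefl refl (begin-strict
      approx w m                   ≡⟨ total≡value {q} {r} q≡r settled m ⟩
      value (approx γ m) (outcome r m)
        ≤⟨ value-mono (0≤γ onset≤m) (γ≤1 onset≤m) (r⊑r′ m) ⟩
      value (approx γ m) (outcome r′ m)   ≡⟨ total≡value {q′} {r′} q′≡r′ settled′ m ⟨
      approx v m                   ≡⟨ ℚₚ.+-identityʳ (approx v m) ⟨
      approx v m ℚ.+ 0ℚ            <⟨ ℚₚ.+-monoʳ-< (approx v m) 0<δ ⟩
      approx v m ℚ.+ δ             ≤⟨ larger m (ℕₚ.m≤n⊔m onset M) ⟩
      approx w m                   ∎)
    where
    open ℚₚ.≤-Reasoning
    v = total {q′} {r′} q′≡r′ settled′
    w = total {q} {r} q≡r settled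
    -- A single index refutes the supposed gap: it lies past `onset`, where values are monotone, and
    -- past `M`, where the gap holds.
    m = onset ℕ.⊔ M
    onset≤m = ℕₚ.m≤m⊔n onset M

-- The game

open Extrema ⊑-totalOrder using (argmax; argmax-all; f[xs]≤f[argmax])

-- A decreasing sequence of decidable subsets of a finite set. The list `ys` covers the current
-- subset, and whenever some entry fails the next predicate, filtering shortens it.
stationary : ∀ {A : Set} {P : ℕ → A → Set} → (∀ h → U.Decidable (P h)) →
  (∀ h x → P (suc h) x → P h x) → ∀ xs → (∀ x → P 0 x → x ∈ xs) →
  ∃[ h ] (∀ x → P h x → P (suc h) x)
stationary {A} {P} P? decreasing xs = search 0 xs (<-wellFounded (length xs))
  where
  search : ∀ h ys → Acc ℕ._<_ (length ys) → (∀ x → P h x → x ∈ ys) →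
    ∃[ h ] (∀ x → P h x → P (suc h) x)
  search h ys (acc rec) ⊆ys with all? (P? (suc h)) ys
  ... | yes stays = h , λ x px → lookupAll stays (⊆ys x px)
  ... | no ¬stays = search (suc h) (filter (P? (suc h)) ys)
    (rec (filter-notAll (P? (suc h)) ys (¬All⇒Any¬ (P? (suc h)) ys ¬stays)))
    (λ x px → ∈-filter⁺ (P? (suc h)) (⊆ys x (decreasing h x px)) px)

vectors : ∀ {A : Set} → List A → ∀ n → List (Vec A n)
vectors xs zero    = [] ∷ []
vectors xs (suc n) = cartesianProductWith _∷_ xs (vectors xs n)

∈-vectors : ∀ {A : Set} {xs : List A} → (∀ x → x ∈ xs) → ∀ {n} (v : Vec A n) → v ∈ vectors xs n
∈-vectors all []      = here refl
∈-vectors all (x ∷ v) = ∈-cartesianProductWith⁺ _∷_ (all x) (∈-vectors all v)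

module Equilibrium (N : ℕ) {k : ℕ} (G : Graph k) where

  open Graph G
  open Game N G

  -- Decidability, finiteness and legal actions

  captureState? : ∀ s → Dec (CaptureState s)
  captureState? s = any? λ m → any? λ n → captures? s m n

  _∈N?[_] : ∀ v x → Dec (v ∈N[ x ])
  v ∈N?[ x ] = (v ≟ x) ⊎-dec (x ~? v)

  infix 4 _≟ₛ_
  _≟ₛ_ : DecidableEquality State
  live (x ▸ p) ≟ₛ live (y ▸ q) with Vec.≡-dec _≟_ x y | p ≟ q
  ... | yes refl | yes refl = yes refl
  ... | no x≢y   | _        = no λ where refl → x≢y refl
  ... | _        | no p≢q   = no λ where refl → p≢q refl
  live _ ≟ₛ s̄      = no λ ()
  s̄      ≟ₛ live _ = no λ ()
  s̄      ≟ₛ s̄      = yes refl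

  states : List State
  states = s̄ ∷ map live (cartesianProductWith _▸_ (vectors (allFin k) N) (allFin N))

  ∈-states : ∀ x → x ∈ states
  ∈-states s̄              = here refl
  ∈-states (live (x ▸ p)) = there (∈-map⁺ live
    (∈-cartesianProductWith⁺ _▸_ (∈-vectors ∈-allFin x) (∈-allFin p)))

  -- Legality for whoever has the move. Nobody has it at `s̄`, where the clause matches
  -- `moverAction`.
  Legal : State → Action → Set
  Legal (live s) a = Allowed (mover s) (live s) a
  Legal s̄        a = a ≡ null

  best : ∀ (f : Action → Outcome) x →
    ∃[ a ] (Legal x a × (∀ {b} → Legal x b → f b ⊑ f a))
  best f s̄ = null , refl , λ where refl → ⊑-refl
  best f (live s) with captureState? s
  ... | yes c = null , captured c , λ where
    (move ¬c _ _)   → contradiction c ¬c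
    (stay ¬c _)     → contradiction c ¬c
    (captured _)    → ⊑-refl
  ... | no ¬c = goto v , move ¬c refl v∈N , λ where
      (move _ _ b∈N)    → lookupAll (f[xs]≤f[argmax] here′ reachable)
                            (∈-filter⁺ (_∈N?[ here′ ]) (∈-allFin _) b∈N)
      (stay _ n≢n)      → contradiction refl n≢n
      (captured c)      → contradiction c ¬c
    where
    here′ = at s (mover s)
    reachable = filter (_∈N?[ here′ ]) (allFin k)
    -- The default of `argmax` has to be legal too; staying put is, as the neighbourhood is closed.
    v = argmax (λ v → f (goto v)) here′ reachable
    v∈N : v ∈N[ here′ ]
    v∈N = argmax-all (λ v → f (goto v)) (inj₁ refl) (all-filter (_∈N?[ here′ ]) (allFin k))

  reward : Player → State → Reward
  reward n (live s) =
    if does (any? λ m → captures? s m n) then penalty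
    else if does (any? λ m → captures? s n m) then gain
    else nil
  reward n s̄ = nil

  turnPayoff≡ : ∀ n x → turnPayoff n x ≡ payoff (reward n x)
  turnPayoff≡ n s̄ = refl
  turnPayoff≡ n (live s)
    with does (any? λ m → captures? s m n) | does (any? λ m → captures? s n m)
  ... | true  | _     = refl
  ... | false | true  = refl
  ... | false | false = refl

  reward-noncapture : ∀ n s → ¬ CaptureState s → reward n (live s) ≡ nil
  reward-noncapture n s ¬c with any? (λ m → captures? s m n) | any? (λ m → captures? s n m)
  ... | yes (m , c) | _           = contradiction (m , n , c) ¬c
  ... | no _        | yes (m , c) = contradiction (n , m , c) ¬c
  ... | no _        | no _        = refl

  -- Player n against the coalition of all others.
  module ZeroSum (n : Player) where

    own : State → Bool
    own (live s) = does (mover s ≟ n)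
    own s̄        = true

    -- Turns the coalition's minimisation into maximisation, so that `best` serves both sides.
    preference : Bool → Outcome → Outcome
    preference true  o = o
    preference false o = opposite o

    truncate-preference : ∀ b h o → truncate h (preference b o) ≡ preference b (truncate h o)
    truncate-preference true  h o = refl
    truncate-preference false h o = truncate-opposite h o

    preference-antisym : ∀ b {o p} → preference b o ⊑ preference b p →
      preference b p ⊑ preference b o → o ≡ p
    preference-antisym true  o⊑p p⊑o = ⊑-antisym o⊑p p⊑o
    preference-antisym false o⊑p p⊑o = ⊑-antisym (opposite-cancel p⊑o) (opposite-cancel o⊑p)

    module Choice (V : State → Outcome) (x : State) where

      private
        optimum = best (λ a → preference (own x) (V (T x a))) x

      choice : Action
      choice = proj₁ optimum

      choice-legal : Legal x choice
      choice-legal = proj₁ (proj₂ optimum)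

      choice-best : ∀ {b} → Legal x b →
        preference (own x) (V (T x b)) ⊑ preference (own x) (V (T x choice))
      choice-best = proj₂ (proj₂ optimum)

    open Choice

    update : (State → Outcome) → State → Outcome
    update V x = reward n x ▹ V (T x (choice V x))

    -- The choices for `V` and `W` may be different actions. Truncation is monotone, so the choice
    -- for `V` is also optimal for `W`, and antisymmetry gives both the same value.
    truncate-update : ∀ h {V W} → (∀ x → truncate h (V x) ≡ W x) →
      ∀ x → truncate (suc h) (update V x) ≡ update W x
    truncate-update h {V} {W} V≈W x = trans
      (truncate-▹ h (reward n x) (V (T x a)))
      (cong (reward n x ▹_) (trans (V≈W (T x a)) (preference-antisym (own x)
        (choice-best W x (choice-legal V x))
        (subst₂ _⊑_ (shorten (T x b)) (shorten (T x a))
          (truncate-mono h (choice-best V x (choice-legal W x)))))))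
      where
      a = choice V x
      b = choice W x
      shorten : ∀ y → truncate h (preference (own x) (V y)) ≡ preference (own x) (W y)
      shorten y = trans (truncate-preference (own x) h (V y)) (cong (preference (own x)) (V≈W y))

    iterate : ℕ → State → Outcome
    iterate zero    _ = draw
    iterate (suc h) = update (iterate h)

    -- `iterate h` solves the game cut off after `h` turns. By `truncate-selective`, a result other
    -- than a draw is therefore final.
    truncate-iterate : ∀ h x → truncate h (iterate (suc h) x) ≡ iterate h x
    truncate-iterate zero    x = refl
    truncate-iterate (suc h) x = truncate-update h (truncate-iterate h) x

    fixedPoint : ∃[ V ] (∀ x → V x ≡ update V x)
    fixedPoint = iterate h , fixed
      where
      isDraw? : ∀ o → Dec (o ≡ draw)
      isDraw? (win _)  = no λ ()
      isDraw? draw     = yes refl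
      isDraw? (loss _) = no λ ()

      stops : ∃[ h ] (∀ x → iterate h x ≡ draw → iterate (suc h) x ≡ draw)
      stops = stationary (λ h x → isDraw? (iterate h x))
        (λ h x eq → trans (sym (truncate-iterate h x))
                      (trans (cong (truncate h) eq) (truncate-draw h)))
        states (λ x _ → ∈-states x)

      h = proj₁ stops

      fixed : ∀ x → iterate h x ≡ iterate (suc h) x
      -- Either the next iterate survives truncation and equals the present one, or the present one
      -- is a draw, which `stops` keeps.
      fixed x with truncate-selective h (iterate (suc h) x)
      ... | inj₁ eq = trans (sym (truncate-iterate h x)) eq
      ... | inj₂ eq = let drawn = trans (sym (truncate-iterate h x)) eq in
        trans drawn (sym (proj₂ stops x drawn))

    val : State → Outcome
    val = proj₁ fixedPoint

    optimal : State → Action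
    optimal = choice val

    optimal-legal : ∀ x → Legal x (optimal x)
    optimal-legal = choice-legal val

    val-fixed : ∀ x → val x ≡ reward n x ▹ val (T x (optimal x))
    val-fixed = proj₂ fixedPoint

    -- The two halves of the Bellman equation for a single transition. A play that falls throughout
    -- earns at most the initial value; one that rises throughout earns at least that.
    Falling Rising : State → State → Set
    Falling x y = reward n x ▹ val y ⊑ val x
    Rising  x y = val x ⊑ reward n x ▹ val y

    optimal-falling : ∀ x → Falling x (T x (optimal x))
    optimal-falling x = ⊑-reflexive (sym (val-fixed x))

    optimal-rising : ∀ x → Rising x (T x (optimal x))
    optimal-rising x = ⊑-reflexive (val-fixed x)

    -- `val` already takes the maximum over the actions of `n`.
    own-falling : ∀ s {a} → mover s ≡ n → Legal (live s) a → Falling (live s) (T (live s) a)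
    own-falling s {a} own≡ legal = subst (reward n x ▹ val (T x a) ⊑_) (sym (val-fixed x))
      (▹-monoʳ (reward n x) (selfish (choice-best val x legal)))
      where
      x = live s
      selfish : preference (own x) (val (T x a)) ⊑ preference (own x) (val (T x (optimal x))) →
        val (T x a) ⊑ val (T x (optimal x))
      selfish p with mover s ≟ n
      ... | yes _ = p
      ... | no ≢n = contradiction own≡ ≢n

    -- `val` already assumes the action worst for `n`, whoever else moves and for whatever reason.
    other-rising : ∀ s {a} → mover s ≢ n → Legal (live s) a → Rising (live s) (T (live s) a)
    other-rising s {a} other legal = subst (_⊑ reward n x ▹ val (T x a)) (sym (val-fixed x))
      (▹-monoʳ (reward n x) (hostile (choice-best val x legal)))
      where
      x = live s
      hostile : preference (own x) (val (T x a)) ⊑ preference (own x) (val (T x (optimal x))) →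
        val (T x (optimal x)) ⊑ val (T x a)
      hostile p with mover s ≟ n
      ... | yes ≡n = contradiction ≡n other
      ... | no _   = opposite-cancel p

    -- The one-step inequalities telescope over `h` turns; at the horizon both sides are cut to a
    -- draw.
    falling-outcome : ∀ (f : ℕ → State) → (∀ t → Falling (f t) (f (suc t))) →
      ∀ h → outcome (reward n ∘ f) h ⊑ truncate h (val (f 0))
    falling-outcome f falling zero    = draw⊑draw
    falling-outcome f falling (suc h) = ⊑-trans
      (▹-monoʳ (reward n (f 0)) (falling-outcome (f ∘ suc) (falling ∘ suc) h))
      (subst (_⊑ truncate (suc h) (val (f 0))) (truncate-▹ h (reward n (f 0)) (val (f 1)))
        (truncate-mono (suc h) (falling 0)))

    rising-outcome : ∀ (f : ℕ → State) → (∀ t → Rising (f t) (f (suc t))) →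
      ∀ h → truncate h (val (f 0)) ⊑ outcome (reward n ∘ f) h
    rising-outcome f rising zero    = draw⊑draw
    rising-outcome f rising (suc h) = ⊑-trans
      (subst (truncate (suc h) (val (f 0)) ⊑_) (truncate-▹ h (reward n (f 0)) (val (f 1)))
        (truncate-mono (suc h) (rising 0)))
      (▹-monoʳ (reward n (f 0)) (rising-outcome (f ∘ suc) (rising ∘ suc) h))

    -- Up to the first difference both sequences earn the same, and there
    -- the value separates what they earn afterwards.
    deviation-outcome : ∀ (d e : ℕ → State) → d 0 ≡ e 0 →
      (∀ t → Rising (e t) (e (suc t))) →
      (∀ t → (∀ u → u ℕ.≤ t → d u ≡ e u) →
        d (suc t) ≡ e (suc t) ⊎ (∀ u → Falling (d (t ℕ.+ u)) (d (suc (t ℕ.+ u))))) →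
      ∀ h → outcome (reward n ∘ d) h ⊑ outcome (reward n ∘ e) h
    deviation-outcome d e d≡e rising deviates zero = draw⊑draw
    deviation-outcome d e d≡e rising deviates (suc h)
      with deviates 0 (λ where zero z≤n → d≡e)
    ... | inj₁ d≡e′ rewrite d≡e = ▹-monoʳ (reward n (e 0))
      (deviation-outcome (d ∘ suc) (e ∘ suc) d≡e′ (rising ∘ suc)
        (λ t agree → deviates (suc t) λ where
          zero    _         → d≡e
          (suc u) (s≤s u≤t) → agree u u≤t) h)
    ... | inj₂ falling = ⊑-trans (falling-outcome d falling (suc h))
      (subst (λ x → truncate (suc h) (val x) ⊑ outcome (reward n ∘ e) (suc h)) (sym d≡e)
        (rising-outcome e rising (suc h)))

  open ZeroSum using (optimal; optimal-legal; Falling; Rising; optimal-falling; optimal-rising;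
                      own-falling; other-rising; deviation-outcome)

  -- The accused, if any, is the first player who failed to play optimally in
  -- his own zero-sum game; from then on everybody plays the zero-sum game of
  -- the accused.
  prescribed : Maybe Player → State → Action
  prescribed accused (live s) = optimal (fromMaybe (mover s) accused) (live s)
  prescribed accused s̄        = null

  -- Histories record states, not actions, so a deviation is recognised by the successor it
  -- produces. An accusation is never revised, which keeps the first deviator accused.
  blame : Maybe Player → State → State → Maybe Player
  blame (just m) _        _ = just m
  blame nothing  s̄        _ = nothing
  blame nothing  (live s) y with y ≟ₛ T (live s) (prescribed nothing (live s))
  ... | yes _ = nothing
  ... | no  _ = just (mover s)

  investigate : Maybe Player → List State → State → Maybe Player
  investigate accused []           _ = accused
  investigate accused (x ∷ [])     s = blame accused x s
  investigate accused (x ∷ y ∷ ys) s = investigate (blame accused x y) (y ∷ ys) s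

  -- Plays extend the history at its end, whereas `investigate` reads it from the front.
  investigate-∷ʳ : ∀ accused past x s →
    investigate accused (past ∷ʳ x) s ≡ blame (investigate accused past x) x s
  investigate-∷ʳ accused []           x s = refl
  investigate-∷ʳ accused (y ∷ [])     x s = refl
  investigate-∷ʳ accused (y ∷ z ∷ zs) x s = investigate-∷ʳ (blame accused y z) (z ∷ zs) x s

  idle : ∀ {m} s → m ≢ mover s → ∃ (Allowed m (live s))
  idle {m} s m≢ with captureState? s
  ... | yes c = null , captured c
  ... | no ¬c = goto (at s m) , stay ¬c m≢

  respond : Maybe Player → ∀ m x → ∃ (Allowed m x)
  respond accused m s̄ = null , ended
  respond accused m (live s) with m ≟ mover s
  ... | yes refl = prescribed accused (live s)
                 , optimal-legal (fromMaybe (mover s) accused) (live s)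
  ... | no m≢    = idle s m≢

  respond-mover : ∀ accused m s → m ≡ mover s →
    proj₁ (respond accused m (live s)) ≡ prescribed accused (live s)
  respond-mover accused m s m≡ with m ≟ mover s
  ... | yes refl = refl
  ... | no m≢    = contradiction m≡ m≢

  threats : Profile
  threats m past x = respond (investigate nothing past x) m x

  moverAction-threats : ∀ past x →
    moverAction threats past x ≡ prescribed (investigate nothing past x) x
  moverAction-threats past (live s) =
    respond-mover (investigate nothing past (live s)) (mover s) s refl
  moverAction-threats past s̄ = refl

  moverAction-legal : ∀ σ past x → Legal x (moverAction σ past x)
  moverAction-legal σ past (live s) = proj₂ (σ (mover s) past (live s))
  moverAction-legal σ past s̄        = refl

  moverAction-other : ∀ σ {n} τ past s → mover s ≢ n →
    moverAction (σ [ n ↦ τ ]) past (live s) ≡ moverAction σ past (live s)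
  moverAction-other σ {n} τ past s other with mover s ≟ n
  ... | yes ≡n = contradiction ≡n other
  ... | no _   = refl

  -- Plays from a fixed initial state

  module _ (s₀ : S) where

    history : Profile → ℕ → List State
    history σ t = proj₁ (play s₀ σ t)

    state : Profile → ℕ → State
    state σ t = proj₂ (play s₀ σ t)

    action : Profile → ℕ → Action
    action σ t = moverAction σ (history σ t) (state σ t)

    accused : Profile → ℕ → Maybe Player
    accused σ t = investigate nothing (history σ t) (state σ t)

    accused-suc : ∀ σ t → accused σ (suc t) ≡ blame (accused σ t) (state σ t) (state σ (suc t))
    accused-suc σ t = investigate-∷ʳ nothing (history σ t) (state σ t) (state σ (suc t))

    s̄-forever : ∀ σ t → state σ t ≡ s̄ → ∀ u → state σ (t ℕ.+ u) ≡ s̄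
    s̄-forever σ t eq zero    = trans (cong (state σ) (ℕₚ.+-identityʳ t)) eq
    s̄-forever σ t eq (suc u) = trans (cong (state σ) (ℕₚ.+-suc t u))
      (cong (λ x → T x (moverAction σ (history σ (t ℕ.+ u)) x)) (s̄-forever σ t eq u))

    capture-ends : ∀ s {a} → CaptureState s → Legal (live s) a → T (live s) a ≡ s̄
    capture-ends s c (move ¬c _ _) = contradiction c ¬c
    capture-ends s c (stay ¬c _)   = contradiction c ¬c
    capture-ends s c (captured _)  = refl

    -- A nonzero reward requires a capture; the only legal action there leads to `s̄`, which is
    -- absorbing and pays nothing.
    rewards-settled : ∀ σ n → Settled (reward n ∘ state σ)
    rewards-settled σ n t = decide (state σ t) refl
      where
      decide : ∀ x → state σ t ≡ x →
        reward n (state σ t) ≡ nil ⊎ (∀ u → reward n (state σ (suc t ℕ.+ u)) ≡ nil)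
      decide s̄ eq = inj₁ (cong (reward n) eq)
      decide (live s) eq with captureState? s
      ... | no ¬c = inj₁ (trans (cong (reward n) eq) (reward-noncapture n s ¬c))
      ... | yes c = inj₂ λ u → cong (reward n) (s̄-forever σ (suc t)
        (trans (cong (λ x → T x (moverAction σ (history σ t) x)) eq)
          (capture-ends s c (moverAction-legal σ (history σ t) (live s)))) u)

    blame-obedient : ∀ x → blame nothing x (T x (prescribed nothing x)) ≡ nothing
    blame-obedient s̄ = refl
    blame-obedient (live s)
      with T (live s) (prescribed nothing (live s)) ≟ₛ T (live s) (prescribed nothing (live s))
    ... | yes _ = refl
    ... | no ≢  = contradiction refl ≢

    blame-deviant : ∀ s y → y ≢ T (live s) (prescribed nothing (live s)) →
      blame nothing (live s) y ≡ just (mover s)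
    blame-deviant s y y≢ with y ≟ₛ T (live s) (prescribed nothing (live s))
    ... | yes y≡ = contradiction y≡ y≢
    ... | no _   = refl

    -- With nobody accused so far, `threats` takes the very action that `blame` checks against.
    nobody-accused : ∀ t → accused threats t ≡ nothing
    nobody-accused zero    = refl
    nobody-accused (suc t) = begin
      accused threats (suc t)
        ≡⟨ accused-suc threats t ⟩
      blame (accused threats t) x (T x (action threats t))
        ≡⟨ cong₂ (λ c a → blame c x (T x a)) (nobody-accused t)
             (moverAction-threats (history threats t) x) ⟩
      blame nothing x (T x (prescribed (accused threats t) x))
        ≡⟨ cong (λ c → blame nothing x (T x (prescribed c x))) (nobody-accused t) ⟩
      blame nothing x (T x (prescribed nothing x))
        ≡⟨ blame-obedient x ⟩
      nothing ∎
      where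
      open ≡-Reasoning
      x = state threats t

    action-threats : ∀ t → action threats t ≡ prescribed nothing (state threats t)
    action-threats t = trans (moverAction-threats (history threats t) (state threats t))
      (cong (λ c → prescribed c (state threats t)) (nobody-accused t))

    -- This holds for all players at once. Where `n` moves, he plays optimally in his own game;
    -- where another moves, that action is selfish but legal, so `other-rising` applies.
    threats-rising : ∀ n t → Rising n (state threats t) (state threats (suc t))
    threats-rising n t = subst (λ a → Rising n x (T x a)) (sym (action-threats t)) (rises x)
      where
      x = state threats t
      rises : ∀ x → Rising n x (T x (prescribed nothing x))
      rises s̄ = optimal-rising n s̄
      rises (live s) with mover s ≟ n
      ... | yes refl = optimal-rising n (live s)
      ... | no other = other-rising n s other (optimal-legal (mover s) (live s))

    -- Unilateral deviations and their punishment

    module Deviation (n : Player) (τ : Strategy n) where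

      deviant : Profile
      deviant = threats [ n ↦ τ ]

      action-other : ∀ t s → state deviant t ≡ live s → mover s ≢ n →
        action deviant t ≡ prescribed (accused deviant t) (live s)
      action-other t s eq other = trans
        (trans (cong (moverAction deviant past) eq) (moverAction-other threats τ past s other))
        (trans (moverAction-threats past (live s))
          (cong (λ x → prescribed (investigate nothing past x) (live s)) (sym eq)))
        where past = history deviant t

      action-legal : ∀ t {x} → state deviant t ≡ x → Legal x (action deviant t)
      action-legal t refl = moverAction-legal deviant (history deviant t) (state deviant t)

      -- The others now play optimally against `n`, and his own moves cannot raise his value.
      punished-falling : ∀ t → accused deviant t ≡ just n →
        Falling n (state deviant t) (state deviant (suc t))
      punished-falling t guilty = falls (state deviant t) refl
        where
        falls : ∀ x → state deviant t ≡ x → Falling n (state deviant t) (state deviant (suc t))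
        falls s̄ eq = subst (λ x → Falling n x (T x (moverAction deviant (history deviant t) x)))
          (sym eq) (optimal-falling n s̄)
        falls (live s) eq with mover s ≟ n
        ... | yes own  = subst (λ x → Falling n x (T x (action deviant t))) (sym eq)
          (own-falling n s own (action-legal t eq))
        ... | no other = subst₂ (λ x a → Falling n x (T x a)) (sym eq)
          (sym (trans (action-other t s eq other) (cong (λ c → prescribed c (live s)) guilty)))
          (optimal-falling n (live s))

      punished-forever : ∀ t → accused deviant t ≡ just n → ∀ u → accused deviant (t ℕ.+ u) ≡ just n
      punished-forever t guilty zero    = trans (cong (accused deviant) (ℕₚ.+-identityʳ t)) guilty
      punished-forever t guilty (suc u) = trans (cong (accused deviant) (ℕₚ.+-suc t u))
        (trans (accused-suc deviant (t ℕ.+ u))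
          (cong (λ c → blame c (state deviant (t ℕ.+ u)) (state deviant (suc (t ℕ.+ u))))
            (punished-forever t guilty u)))

      -- Strategies read the whole history, so agreement of the states has to be lifted to the
      -- histories.
      agree-play : ∀ t → (∀ u → u ℕ.≤ t → state deviant u ≡ state threats u) →
        play s₀ deviant t ≡ play s₀ threats t
      agree-play zero    agree = refl
      agree-play (suc t) agree = cong₂ _,_
        (cong (λ where (past , x) → past ∷ʳ x)
          (agree-play t (λ u u≤t → agree u (ℕₚ.m≤n⇒m≤1+n u≤t))))
        (agree (suc t) ℕₚ.≤-refl)

      deviates : ∀ t → (∀ u → u ℕ.≤ t → state deviant u ≡ state threats u) →
        state deviant (suc t) ≡ state threats (suc t) ⊎
        (∀ u → Falling n (state deviant (t ℕ.+ u)) (state deviant (suc (t ℕ.+ u))))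
      deviates t agree = decide (state deviant t) refl
        where
        same : play s₀ deviant t ≡ play s₀ threats t
        same = agree-play t agree

        innocent : accused deviant t ≡ nothing
        innocent = trans (cong (λ where (past , x) → investigate nothing past x) same)
          (nobody-accused t)

        expected : state threats (suc t) ≡ T (state deviant t) (prescribed nothing (state deviant t))
        expected = trans (cong (T (state threats t)) (action-threats t))
          (cong (λ x → T x (prescribed nothing x)) (sym (cong proj₂ same)))

        decide : ∀ x → state deviant t ≡ x →
          state deviant (suc t) ≡ state threats (suc t) ⊎
          (∀ u → Falling n (state deviant (t ℕ.+ u)) (state deviant (suc (t ℕ.+ u))))
        decide s̄ eq = inj₁ (trans
          (cong (λ x → T x (moverAction deviant (history deviant t) x)) eq)
          (sym (trans expected (cong (λ x → T x (prescribed nothing x)) eq))))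
        decide (live s) eq with state deviant (suc t) ≟ₛ state threats (suc t) | mover s ≟ n
        ... | yes d≡e | _        = inj₁ d≡e
        -- The other players still follow `threats` on the common history, so the successors cannot
        -- differ.
        ... | no d≢e  | no other = contradiction
          (trans (cong₂ T eq (trans (action-other t s eq other)
                               (cong (λ c → prescribed c (live s)) innocent)))
            (sym (trans expected (cong (λ x → T x (prescribed nothing x)) eq)))) d≢e
        -- The accusation takes effect only at `suc t`. The deviating turn itself falls because `n`
        -- moves there.
        ... | no d≢e  | yes own  = inj₂ λ where
            zero    → subst (λ v → Falling n (state deviant v) (state deviant (suc v)))
              (sym (ℕₚ.+-identityʳ t))
              (subst (λ x → Falling n x (T x (action deviant t))) (sym eq)
                (own-falling n s own (action-legal t eq)))
            (suc u) → subst (λ v → Falling n (state deviant v) (state deviant (suc v)))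
              (sym (ℕₚ.+-suc t u))
              (punished-falling (suc t ℕ.+ u) (punished-forever (suc t) guilty u))
          where
          guilty : accused deviant (suc t) ≡ just n
          guilty = trans (accused-suc deviant t)
            (trans (cong₂ (λ c x → blame c x (state deviant (suc t))) innocent eq)
              (trans (blame-deviant s (state deviant (suc t)) λ d≡ → d≢e
                       (trans d≡ (sym (trans expected
                         (cong (λ x → T x (prescribed nothing x)) eq)))))
                (cong just own)))

      deviation-unprofitable : ∀ h →
        outcome (reward n ∘ state deviant) h ⊑ outcome (reward n ∘ state threats) h
      deviation-unprofitable = deviation-outcome n (state deviant) (state threats) refl
        (threats-rising n) deviates

  -- Total payoffs and the equilibrium

  module _ {γ : ℝ} (γ-discount : Discount γ) (s₀ : S) (n : Player) where

    open Discounting γ-discount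

    rewards : Profile → ℕ → Reward
    rewards σ t = reward n (state s₀ σ t)

    payoffs≡ : ∀ σ t → turnPayoff n (proj₂ (play s₀ σ t)) ≡ payoff (rewards σ t)
    payoffs≡ σ t = turnPayoff≡ n (state s₀ σ t)

    totalPayoff : Profile → ℝ
    totalPayoff σ = total {λ t → turnPayoff n (proj₂ (play s₀ σ t))} {rewards σ}
      (payoffs≡ σ) (rewards-settled s₀ σ n)

    isTotalPayoff : ∀ σ → TotalPayoff γ s₀ σ n (totalPayoff σ)
    isTotalPayoff σ = hasSum-total {λ t → turnPayoff n (proj₂ (play s₀ σ t))} {rewards σ}
      (payoffs≡ σ) (rewards-settled s₀ σ n)

    totalPayoff-mono : ∀ σ σ′ → (∀ h → outcome (rewards σ) h ⊑ outcome (rewards σ′) h) →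
      totalPayoff σ ≤ totalPayoff σ′
    totalPayoff-mono σ σ′ = total-mono
      {λ t → turnPayoff n (proj₂ (play s₀ σ t))} {rewards σ}
      {λ t → turnPayoff n (proj₂ (play s₀ σ′ t))} {rewards σ′}
      (payoffs≡ σ) (rewards-settled s₀ σ n) (payoffs≡ σ′) (rewards-settled s₀ σ′ n)

  threats-equilibrium : ∀ {γ} → Discount γ → ∀ s₀ → IsNashEquilibrium γ s₀ threats
  threats-equilibrium γ-discount s₀ n τ =
      totalPayoff γ-discount s₀ n threats
    , totalPayoff γ-discount s₀ n (threats [ n ↦ τ ])
    , isTotalPayoff γ-discount s₀ n threats
    , isTotalPayoff γ-discount s₀ n (threats [ n ↦ τ ])
    , totalPayoff-mono γ-discount s₀ n (threats [ n ↦ τ ]) threats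
        (Deviation.deviation-unprofitable s₀ n τ)

theorem6p1 : (N : ℕ) → 4 ℕ.≤ N →
    (k : ℕ) (G : Graph k) (s₀ : Game.S N G) (γ : ℝ) → 0ℝ < γ → γ < 1ℝ →
    ∃ (λ (π : Game.Profile N G) → Game.IsNashEquilibrium N G γ s₀ π)
theorem6p1 N _ k G s₀ γ 0<γ γ<1 =
  threats , threats-equilibrium (discount γ 0<γ γ<1) s₀
  where open Equilibrium N G
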